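{- Let $F(\alpha,\beta)=\sum_{m\ge0}\frac{\alpha^m\beta^{\binom m2}}{m!}$. Then, as formal power series, \[ 1+\sum_{n\ge 1}\sum_{d\ge 2} f_{d-2}(\Sigma_{n,n})\,\frac{x^d}{d!}\,\frac{y^n}{n!}=\frac{F(x,e^y)}{e^x}, \] where $f_i(\Sigma_{n,n})$ is the number of $i$-dimensional cones of the bipermutahedral fan $\Sigma_{n,n}$.
   Context: Let $N_n=\mathbb{R}^n/\mathbb{R}(1,\dots,1)$. For $S\subseteq[n]$ let $\mathsf{e}_S$ (resp. $\mathsf{f}_S$) denote the image in the first (resp. second) factor of $N_n\times N_n$ of the indicator vector of $S$. A bipermutation of $[n]$ is a sequence $b_1|\cdots|b_{2n-1}$ of elements of $[n]$ in which one element appears exactly once and every other element exactly twice. The bipermutahedral fan $\Sigma_{n,n}$ is the complete simplicial fan in $N_n\times N_n$ whose maximal cones are, for each bipermutation $\mathsf{B}=b_1|\cdots|b_{2n-1}$, the cones $\mathrm{cone}\{\mathsf{e}_{\{b_1,\dots,b_m\}}+\mathsf{f}_{\{b_{m+1},\dots,b_{2n-1}\}}:1\le m\le 2n-2\}$, together with all their faces. (For $n=1$, $N_1=0$ and $\Sigma_{1,1}$ consists of the single zero-dimensional cone.) $f_i(\Sigma_{n,n})=0$ when $i>2n-2$. -}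

module Defs where

open import Data.Nat as ℕ using (ℕ; zero; suc; _∸_; _≡ᵇ_)
open import Data.Nat.Properties using (_!≢0)
open import Data.Nat.Combinatorics using (_C_)
open import Data.Bool as Bool using (Bool; true; false; _∧_; _∨_; if_then_else_)
open import Data.Fin as Fin using (Fin)
open import Data.Fin.Subset using (Subset; ⁅_⁆; _∪_) renaming (⊥ to ∅)
open import Data.List as List using (List; []; _∷_; _++_; [_]; map; concatMap; filter; length; take; drop; allFin; upTo; deduplicate)
open import Data.Bool.ListAction using (any; all)
import Data.List.Properties as LP
import Data.Vec.Properties as VP
import Data.Product.Properties as PP
open import Data.Vec using (Vec)
open import Data.Product using (_×_; _,_)
open import Data.Integer using (+_)
open import Data.Rational as ℚ using (ℚ; 0ℚ; 1ℚ; _+_; _*_)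
open import Relation.Nullary.Decidable using (does)
open import Relation.Binary.Definitions using (DecidableEquality)

words : (n k : ℕ) → List (List (Fin n))
words n zero    = [ [] ]
words n (suc k) = concatMap (λ w → map (_∷ w) (allFin n)) (words n k)

count : {n : ℕ} → Fin n → List (Fin n) → ℕ
count i w = length (filter (λ j → j Fin.≟ i) w)

isBipermutation : (n : ℕ) → List (Fin n) → Bool
isBipermutation n w =
  (length w ≡ᵇ (2 ℕ.* n ∸ 1))
  ∧ all (λ i → (count i w ≡ᵇ 1) ∨ (count i w ≡ᵇ 2)) (allFin n)
  ∧ (length (filter (λ i → count i w ℕ.≟ 1) (allFin n)) ≡ᵇ 1)

bipermutations : (n : ℕ) → List (List (Fin n))
bipermutations n = filter (λ w → Bool.T? (isBipermutation n w)) (words n (2 ℕ.* n ∸ 1))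

setOf : {n : ℕ} → List (Fin n) → Subset n
setOf = List.foldr (λ i s → ⁅ i ⁆ ∪ s) ∅

isFull : {n : ℕ} → Subset n → Bool
isFull Vec.[]      = true
isFull (b Vec.∷ s) = b ∧ isFull s

-- The image of the indicator vector of S in N_n = ℝ^n / ℝ(1,...,1).
-- For 0/1-vectors, two indicator vectors have the same image in N_n iff they
-- are equal or are {the all-zero, the all-one} vector; so the class of the
-- indicator of S is faithfully represented by S with [n] replaced by ∅.
classN : {n : ℕ} → Subset n → Subset n
classN S = if isFull S then ∅ else S

-- A ray e_S + f_T ∈ N_n × N_n, represented by (class of S, class of T).
Ray : ℕ → Set
Ray n = Subset n × Subset n

_≟Ray_ : {n : ℕ} → DecidableEquality (Ray n)
_≟Ray_ = PP.≡-dec (VP.≡-dec Bool._≟_) (VP.≡-dec Bool._≟_)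

ray : {n : ℕ} → Subset n → Subset n → Ray n
ray S T = classN S , classN T

-- The generators e_{b_1..b_m} + f_{b_{m+1}..b_{2n-1}}, 1 ≤ m ≤ 2n-2, of the
-- maximal cone of the bipermutation w.
raysOf : (n : ℕ) → List (Fin n) → List (Ray n)
raysOf n w = map (λ m → ray (setOf (take m w)) (setOf (drop m w)))
                 (map suc (upTo (2 ℕ.* n ∸ 2)))

subsets : (n : ℕ) → List (Subset n)
subsets zero    = [ Vec.[] ]
subsets (suc n) = concatMap (λ s → (true Vec.∷ s) ∷ (false Vec.∷ s) ∷ []) (subsets n)

rayUniverse : (n : ℕ) → List (Ray n)
rayUniverse n = concatMap (λ S → map (S ,_) (subsets n)) (subsets n)

-- A finite set of rays, encoded canonically by its membership vector over
-- the ray universe (so equal sets get equal codes).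
code : {n : ℕ} → List (Ray n) → List Bool
code {n} R = map (λ r → any (λ r′ → does (r ≟Ray r′)) R) (rayUniverse n)

card : List Bool → ℕ
card c = length (filter Bool.T? c)

choose : {A : Set} → ℕ → List A → List (List A)
choose zero    _        = [ [] ]
choose (suc i) []       = []
choose (suc i) (x ∷ xs) = map (x ∷_) (choose i xs) ++ choose (suc i) xs

-- Σ_{n,n} is simplicial, so its cones are exactly the cones spanned by subsets
-- of the generator sets of maximal cones, and an i-dimensional cone is spanned
-- by exactly i rays.  The i-dimensional cones are thus the distinct i-element
-- sets of rays contained in the ray set of some maximal cone.
iCones : (n i : ℕ) → List (List Bool)
iCones n i =
  deduplicate (LP.≡-dec Bool._≟_)
    (filter (λ c → card c ℕ.≟ i)
      (concatMap (λ w → map code (choose i (raysOf n w))) (bipermutations n)))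

fSigma : (i n : ℕ) → ℕ
fSigma i n = length (iCones n i)

invFact : ℕ → ℚ
invFact k = ℚ._/_ (+ 1) (k ℕ.!) {{k !≢0}}

sumTo : (ℕ → ℚ) → ℕ → ℚ
sumTo f zero    = f zero
sumTo f (suc n) = sumTo f n + f (suc n)

Series1 : Set
Series1 = ℕ → ℚ

one1 : Series1
one1 zero    = 1ℚ
one1 (suc _) = 0ℚ

mul1 : Series1 → Series1 → Series1
mul1 s t b = sumTo (λ j → s j * t (b ∸ j)) b

pow1 : Series1 → ℕ → Series1
pow1 s zero    = one1
pow1 s (suc k) = mul1 s (pow1 s k)

expY : Series1
expY b = invFact b

-- two-variable formal power series in x, y: A a b = coefficient of x^a y^b
Series2 : Set
Series2 = ℕ → ℕ → ℚ

mul2 : Series2 → Series2 → Series2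
mul2 A B a b = sumTo (λ i → sumTo (λ j → A i j * B (a ∸ i) (b ∸ j)) b) a

expX : Series2
expX a zero    = invFact a
expX a (suc _) = 0ℚ

-- F(x, e^y) = Σ_{m≥0} x^m (e^y)^{binom m 2} / m!
-- (F(α,β) = Σ_m α^m β^{binom m 2}/m! with α := x, β := e^y)
FxExpY : Series2
FxExpY a b = invFact a * pow1 expY (a C 2) b

LHS : Series2
LHS zero          zero    = 1ℚ
LHS (suc (suc d)) (suc n) = ℚ._/_ (+ fSigma d (suc n)) 1 * invFact (suc (suc d)) * invFact (suc n)
LHS _             _       = 0ℚ

{-# OPTIONS --safe #-}

-- An i-dimensional cone of Σ_{n,n} is a chain of i rays, which cuts a
-- bipermutation into i + 1 nonempty blocks. It is determined by recording, for
-- every element, the block p of its first and the block r ≥ p of its last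
-- occurrence. The words of n letters (p , r) that arise are those that use
-- every block and contain a loop p = r (the element occurring once).
--
-- On t given blocks there are C(t+1,2)^n words, C(t,2)^n of them without a
-- loop; the difference is Δh(t) for h(t) = C(t,2)^n. Inclusion–exclusion over
-- the set of blocks used gives f_i = Δ^(i+1)(Δh)(0) = Δ^(i+2) h(0), and
-- h(0) = Δh(0) = 0 for n ≥ 1. Multiplying by e^x is then Newton's forward
-- difference formula, and h(a) / n! is the coefficient of y^n in (e^y)^C(a,2).
module Submission where

open import Defs
open import Data.Nat as ℕ using (ℕ; zero; suc; _∸_; _≤_; _<_; z≤n; s≤s; _≡ᵇ_; _≤ᵇ_; _<ᵇ_)
open import Data.Nat.Combinatorics using (_C_; nC1≡n; nCk+nC[k+1]≡[n+1]C[k+1])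
import Data.Nat.Properties as ℕₚ
open import Data.Integer as ℤ using (+_)
import Data.Integer.Properties as ℤₚ
open import Data.Rational as ℚ using (ℚ; 0ℚ; 1ℚ; _+_; _*_; _-_; _/_)
import Data.Rational.Properties as ℚₚ
open import Data.Rational.Solver using (module +-*-Solver)
open import Data.Rational.Unnormalised as ℚᵘ using (mkℚᵘ; *≡*)
import Data.Rational.Unnormalised.Properties as ℚᵘₚ
open import Data.Bool as Bool using (Bool; true; false; T; _∧_; _∨_; not; if_then_else_)
open import Data.Bool.ListAction using (any; all)
import Data.Bool.Properties as Boolₚ
open import Data.Fin as Fin using (Fin; toℕ)
open import Data.Fin.Subset as Subset using (Subset; Nonempty) renaming (_∈_ to _∈ₛ_; ⊥ to ∅; ⊤ to full)
import Data.Fin.Subset.Properties as Subsetₚ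
open import Data.List as List using (List; []; _∷_; _++_; [_]; map; upTo; applyUpTo; cartesianProductWith; concatMap; filter; length; take; drop; allFin)
import Data.List.Properties as Listₚ
open import Data.List.Membership.Propositional using (_∈_; lose; find)
open import Data.List.Membership.Propositional.Properties
open import Data.List.Membership.Propositional.Properties.WithK using (unique∧set⇒bag)
open import Data.List.Relation.Binary.BagAndSetEquality using (∼bag⇒↭)
open import Data.List.Relation.Binary.Permutation.Propositional as Perm using (_↭_)
open import Data.List.Relation.Binary.Permutation.Propositional.Properties using (↭-length)
open import Data.List.Relation.Unary.All as All using (All; []; _∷_)
open import Data.List.Relation.Unary.AllPairs using (AllPairs; []; _∷_)
import Data.List.Relation.Unary.AllPairs.Properties as AllPairsₚ
open import Data.List.Relation.Unary.Any as Any using (here; there)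
import Data.List.Relation.Unary.Unique.DecPropositional.Properties as DecUniqueₚ
open import Data.List.Relation.Unary.Unique.Propositional using (Unique)
import Data.List.Relation.Unary.Unique.Propositional.Properties as Uniqueₚ
open import Data.Vec as Vec using (Vec; []; _∷_; lookup)
import Data.Vec.Properties as Vecₚ
open import Data.Product as Product using (_×_; _,_; proj₁; proj₂; ∃)
open import Data.Sum using (_⊎_; inj₁; inj₂)
open import Data.Empty using (⊥-elim)
open import Data.Unit using (tt)
open import Function using (_∘_; id; Equivalence; mk⇔)
open import Relation.Nullary using (¬_; yes; no; does)
open import Relation.Nullary.Decidable using (dec-true; dec-false)
open import Relation.Binary.PropositionalEquality hiding ([_])
open import Algebra.Properties.CommutativeSemigroup ℕₚ.+-commutativeSemigroup using () renaming (interchange to +-interchange)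

open Equivalence using (to; from)

-- Formal power series and finite differences

-- A loop need not be the element that occurs once, since both copies of an element may fall into
-- one block. Hence a word can have several loops, and many bipermutations give the same cone; when
-- a word is refined to a bipermutation, any one of its loops may be declared the single element.
-- Recovering a word from its cone meets two obstacles: the rays form an unordered set, and the
-- empty set and [n] have the same class in N_n. The second disappears because the first and the
-- last block are both used: this makes the two sets of each ray nonempty, so that a zero class can
-- only come from [n]. The first disappears because `p` and `r` are numbers of rays with a given
-- property. On the analytic side, derivatives of coefficient sequences take the place of binomial
-- identities.

ι : ℕ → ℚ
ι n = + n / 1

-- Division by `1` normalises through a gcd that is stuck on a variable, so identities about `ι` are
-- checked on unnormalised representatives.
toℚᵘ-ι : ∀ n → ℚ.toℚᵘ (ι n) ℚᵘ.≃ mkℚᵘ (+ n) 0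
toℚᵘ-ι n = ℚₚ.toℚᵘ-fromℚᵘ (mkℚᵘ (+ n) 0)

ι-+ : ∀ m n → ι (m ℕ.+ n) ≡ ι m + ι n
ι-+ m n = ℚₚ.toℚᵘ-injective (begin
  ℚ.toℚᵘ (ι (m ℕ.+ n))               ≈⟨ toℚᵘ-ι (m ℕ.+ n) ⟩
  mkℚᵘ (+ (m ℕ.+ n)) 0               ≈⟨ *≡* (cong (ℤ._* + 1) (cong₂ ℤ._+_ (sym (ℤₚ.*-identityʳ (+ m))) (sym (ℤₚ.*-identityʳ (+ n))))) ⟩
  mkℚᵘ (+ m) 0 ℚᵘ.+ mkℚᵘ (+ n) 0     ≈⟨ ℚᵘₚ.+-cong (toℚᵘ-ι m) (toℚᵘ-ι n) ⟨
  ℚ.toℚᵘ (ι m) ℚᵘ.+ ℚ.toℚᵘ (ι n)     ≈⟨ ℚₚ.toℚᵘ-homo-+ (ι m) (ι n) ⟨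
  ℚ.toℚᵘ (ι m + ι n)                 ∎)
  where open ℚᵘₚ.≃-Reasoning

ι-* : ∀ m n → ι (m ℕ.* n) ≡ ι m * ι n
ι-* zero    n = sym (ℚₚ.*-zeroˡ (ι n))
ι-* (suc m) n = begin
  ι (n ℕ.+ m ℕ.* n)      ≡⟨ ι-+ n (m ℕ.* n) ⟩
  ι n + ι (m ℕ.* n)      ≡⟨ cong₂ _+_ (sym (ℚₚ.*-identityˡ (ι n))) (ι-* m n) ⟩
  ι 1 * ι n + ι m * ι n  ≡⟨ ℚₚ.*-distribʳ-+ (ι n) (ι 1) (ι m) ⟨
  (ι 1 + ι m) * ι n      ≡⟨ cong (_* ι n) (ι-+ 1 m) ⟨
  ι (suc m) * ι n        ∎
  where open ≡-Reasoning

ι-inverse : ∀ d .{{_ : ℕ.NonZero d}} → ι d * (+ 1 / d) ≡ 1ℚ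
ι-inverse (suc d) = ℚₚ.toℚᵘ-injective (begin
  ℚ.toℚᵘ (ι (suc d) * (+ 1 / suc d))               ≈⟨ ℚₚ.toℚᵘ-homo-* (ι (suc d)) (+ 1 / suc d) ⟩
  ℚ.toℚᵘ (ι (suc d)) ℚᵘ.* ℚ.toℚᵘ (+ 1 / suc d)     ≈⟨ ℚᵘₚ.*-cong (toℚᵘ-ι (suc d)) (ℚₚ.toℚᵘ-fromℚᵘ (mkℚᵘ (+ 1) d)) ⟩
  mkℚᵘ (+ suc d) 0 ℚᵘ.* mkℚᵘ (+ 1) d               ≈⟨ ℚᵘₚ.*-inverseʳ (mkℚᵘ (+ suc d) 0) ⟩
  mkℚᵘ (+ 1) 0                                     ∎)
  where open ℚᵘₚ.≃-Reasoning

-- Cancellation of a positive factor is used for the order; antisymmetry turns it into cancellation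
-- in an equation.
ι-cancel : ∀ k .{{_ : ℕ.NonZero k}} {p q} → ι k * p ≡ ι k * q → p ≡ q
ι-cancel k eq = ℚₚ.≤-antisym (cancel (ℚₚ.≤-reflexive eq)) (cancel (ℚₚ.≤-reflexive (sym eq)))
  where
  cancel : ∀ {p q} → ι k * p ℚ.≤ ι k * q → p ℚ.≤ q
  cancel = ℚₚ.*-cancelˡ-≤-pos (ι k) {{ℚₚ.normalize-pos k 1}}

-- The formal derivative. The exponential is its own derivative, which yields recursions both for
-- the powers of e^y and for Newton's formula.
D : Series1 → Series1
D s k = ι (suc k) * s (suc k)

D-invFact : ∀ k → D invFact k ≡ invFact k
D-invFact k = ι-cancel (k ℕ.!) {{k ℕₚ.!≢0}} (begin
  ι (k ℕ.!) * (ι (suc k) * invFact (suc k))  ≡⟨ ℚₚ.*-assoc (ι (k ℕ.!)) (ι (suc k)) (invFact (suc k)) ⟨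
  ι (k ℕ.!) * ι (suc k) * invFact (suc k)    ≡⟨ cong (_* invFact (suc k)) (ℚₚ.*-comm (ι (k ℕ.!)) (ι (suc k))) ⟩
  ι (suc k) * ι (k ℕ.!) * invFact (suc k)    ≡⟨ cong (_* invFact (suc k)) (ι-* (suc k) (k ℕ.!)) ⟨
  ι (suc k ℕ.!) * invFact (suc k)            ≡⟨ ι-inverse (suc k ℕ.!) {{suc k ℕₚ.!≢0}} ⟩
  1ℚ                                         ≡⟨ ι-inverse (k ℕ.!) {{k ℕₚ.!≢0}} ⟨
  ι (k ℕ.!) * invFact k                      ∎)
  where open ≡-Reasoning

open +-*-Solver using (solve; con; _:=_; _:+_; _:*_; _:-_)

sumTo-cong : ∀ {f g} n → (∀ {j} → j ℕ.≤ n → f j ≡ g j) → sumTo f n ≡ sumTo g n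
sumTo-cong zero    f≡g = f≡g z≤n
sumTo-cong (suc n) f≡g = cong₂ _+_ (sumTo-cong n (λ j≤n → f≡g (ℕₚ.m≤n⇒m≤1+n j≤n))) (f≡g ℕₚ.≤-refl)

sumTo-+ : ∀ f g n → sumTo (λ j → f j + g j) n ≡ sumTo f n + sumTo g n
sumTo-+ f g zero    = refl
sumTo-+ f g (suc n) = trans (cong (_+ (f (suc n) + g (suc n))) (sumTo-+ f g n))
  (solve 4 (λ a b c d → (a :+ b) :+ (c :+ d) := (a :+ c) :+ (b :+ d)) refl
    (sumTo f n) (sumTo g n) (f (suc n)) (g (suc n)))

sumTo-*ˡ : ∀ c f n → c * sumTo f n ≡ sumTo (λ j → c * f j) n
sumTo-*ˡ c f zero    = refl
sumTo-*ˡ c f (suc n) = trans (ℚₚ.*-distribˡ-+ c (sumTo f n) (f (suc n))) (cong (_+ c * f (suc n)) (sumTo-*ˡ c f n))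

sumTo-head : ∀ f n → sumTo f (suc n) ≡ f 0 + sumTo (λ j → f (suc j)) n
sumTo-head f zero    = refl
sumTo-head f (suc n) = trans (cong (_+ f (suc (suc n))) (sumTo-head f n)) (ℚₚ.+-assoc (f 0) _ _)

sumTo-0 : ∀ n → sumTo (λ _ → 0ℚ) n ≡ 0ℚ
sumTo-0 zero    = refl
sumTo-0 (suc n) = trans (ℚₚ.+-identityʳ _) (sumTo-0 n)

mul1-cong : ∀ {s s′ t t′} → (∀ k → s k ≡ s′ k) → (∀ k → t k ≡ t′ k) → ∀ n → mul1 s t n ≡ mul1 s′ t′ n
mul1-cong s≡s′ t≡t′ n = sumTo-cong n (λ {j} _ → cong₂ _*_ (s≡s′ j) (t≡t′ (n ∸ j)))

mul1-scale : ∀ c s t n → mul1 s (λ k → c * t k) n ≡ c * mul1 s t n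
mul1-scale c s t n = trans
  (sumTo-cong n (λ {j} _ → solve 3 (λ c a b → a :* (c :* b) := c :* (a :* b)) refl c (s j) (t (n ∸ j))))
  (sym (sumTo-*ˡ c _ n))

-- In degree n the factor n + 1 splits as j + (n + 1 ∸ j) on the j-th term.
D-mul1 : ∀ s t n → D (mul1 s t) n ≡ mul1 (D s) t n + mul1 s (D t) n
D-mul1 s t n = begin
  ι (suc n) * sumTo term (suc n)
    ≡⟨ sumTo-*ˡ (ι (suc n)) term (suc n) ⟩
  sumTo (λ j → ι (suc n) * term j) (suc n)
    ≡⟨ sumTo-cong (suc n) split ⟩
  sumTo (λ j → ι j * term j + ι (suc n ∸ j) * term j) (suc n)
    ≡⟨ sumTo-+ _ _ (suc n) ⟩
  sumTo (λ j → ι j * term j) (suc n) + sumTo (λ j → ι (suc n ∸ j) * term j) (suc n)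
    ≡⟨ cong₂ _+_ left right ⟩
  mul1 (D s) t n + mul1 s (D t) n
    ∎
  where
  open ≡-Reasoning
  term : ℕ → ℚ
  term j = s j * t (suc n ∸ j)
  split : ∀ {j} → j ℕ.≤ suc n → ι (suc n) * term j ≡ ι j * term j + ι (suc n ∸ j) * term j
  split {j} j≤ = trans (cong (_* term j) (trans (cong ι (sym (ℕₚ.m+[n∸m]≡n j≤))) (ι-+ j (suc n ∸ j))))
    (ℚₚ.*-distribʳ-+ (term j) (ι j) (ι (suc n ∸ j)))
  left : sumTo (λ j → ι j * term j) (suc n) ≡ mul1 (D s) t n
  left = trans (sumTo-head _ n) (trans (cong (_+ sumTo (λ j → ι (suc j) * term (suc j)) n) (ℚₚ.*-zeroˡ (term 0)))
    (trans (ℚₚ.+-identityˡ _) (sumTo-cong n (λ {j} _ → sym (ℚₚ.*-assoc (ι (suc j)) (s (suc j)) (t (n ∸ j)))))))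
  right : sumTo (λ j → ι (suc n ∸ j) * term j) (suc n) ≡ mul1 s (D t) n
  right = trans (cong₂ _+_ (sumTo-cong n inner)
      (trans (cong (λ k → ι k * term (suc n)) (ℕₚ.n∸n≡0 n)) (ℚₚ.*-zeroˡ (term (suc n)))))
    (ℚₚ.+-identityʳ _)
    where
    inner : ∀ {j} → j ℕ.≤ n → ι (suc n ∸ j) * term j ≡ s j * D t (n ∸ j)
    inner {j} j≤n rewrite ℕₚ.+-∸-assoc 1 j≤n =
      solve 3 (λ a b c → a :* (b :* c) := b :* (a :* c)) refl (ι (suc (n ∸ j))) (s j) (t (suc (n ∸ j)))

-- Leibniz rule on e^y times (e^y)^k: the first factor contributes 1, the second contributes `k` by
-- induction.
D-pow1-expY : ∀ k n → D (pow1 expY k) n ≡ ι k * pow1 expY k n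
D-pow1-expY zero    n = trans (ℚₚ.*-zeroʳ (ι (suc n))) (sym (ℚₚ.*-zeroˡ (one1 n)))
D-pow1-expY (suc k) n = begin
  D (mul1 expY (pow1 expY k)) n
    ≡⟨ D-mul1 expY (pow1 expY k) n ⟩
  mul1 (D expY) (pow1 expY k) n + mul1 expY (D (pow1 expY k)) n
    ≡⟨ cong₂ _+_ (mul1-cong {t = pow1 expY k} D-invFact (λ _ → refl) n) (trans (mul1-cong {expY} (λ _ → refl) (D-pow1-expY k) n) (mul1-scale (ι k) expY (pow1 expY k) n)) ⟩
  pow1 expY (suc k) n + ι k * pow1 expY (suc k) n
    ≡⟨ cong (_+ ι k * pow1 expY (suc k) n) (ℚₚ.*-identityˡ (pow1 expY (suc k) n)) ⟨
  ι 1 * pow1 expY (suc k) n + ι k * pow1 expY (suc k) n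
    ≡⟨ ℚₚ.*-distribʳ-+ (pow1 expY (suc k) n) (ι 1) (ι k) ⟨
  (ι 1 + ι k) * pow1 expY (suc k) n
    ≡⟨ cong (_* pow1 expY (suc k) n) (ι-+ 1 k) ⟨
  ι (suc k) * pow1 expY (suc k) n
    ∎
  where open ≡-Reasoning

pow1-expY-0 : ∀ k → pow1 expY k 0 ≡ 1ℚ
pow1-expY-0 zero    = refl
pow1-expY-0 (suc k) = trans (ℚₚ.*-identityˡ _) (pow1-expY-0 k)

-- The equation f' = k f with constant term 1 is a recursion on coefficients, and its solution is
-- k^n / n!.
pow1-expY : ∀ k n → pow1 expY k n ≡ ι (k ℕ.^ n) * invFact n
pow1-expY k zero    = pow1-expY-0 k
pow1-expY k (suc n) = ι-cancel (suc n) (begin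
  ι (suc n) * pow1 expY k (suc n)                      ≡⟨ D-pow1-expY k n ⟩
  ι k * pow1 expY k n                                  ≡⟨ cong (ι k *_) (pow1-expY k n) ⟩
  ι k * (ι (k ℕ.^ n) * invFact n)                      ≡⟨ ℚₚ.*-assoc (ι k) (ι (k ℕ.^ n)) (invFact n) ⟨
  ι k * ι (k ℕ.^ n) * invFact n                        ≡⟨ cong₂ _*_ (ι-* k (k ℕ.^ n)) (D-invFact n) ⟨
  ι (k ℕ.^ suc n) * (ι (suc n) * invFact (suc n))      ≡⟨ solve 3 (λ a b c → a :* (b :* c) := b :* (a :* c)) refl (ι (k ℕ.^ suc n)) (ι (suc n)) (invFact (suc n)) ⟩
  ι (suc n) * (ι (k ℕ.^ suc n) * invFact (suc n))      ∎)
  where open ≡-Reasoning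

Δ : (ℕ → ℚ) → (ℕ → ℚ)
Δ h t = h (suc t) - h t

-- The new difference is taken innermost, so dropping the first term of the sequence of iterated
-- differences at 0 means replacing `h` by `Δ h`. Both the induction for Newton's formula and
-- inclusion-exclusion proceed in this way.
Δ^ : ℕ → (ℕ → ℚ) → (ℕ → ℚ)
Δ^ zero    h = h
Δ^ (suc d) h = Δ^ d (Δ h)

-- Newton's forward difference formula, divided by n!.
newton : ∀ h n → mul1 (λ d → Δ^ d h 0 * invFact d) invFact n ≡ h n * invFact n
newton h zero    = solve 1 (λ a → a :* con 1ℚ :* con 1ℚ := a :* con 1ℚ) refl (h 0)
newton h (suc n) = ι-cancel (suc n) (begin
  D (mul1 egf invFact) n
    ≡⟨ D-mul1 egf invFact n ⟩
  mul1 (D egf) invFact n + mul1 egf (D invFact) n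
    ≡⟨ cong₂ _+_ (mul1-cong {t = invFact} D-egf (λ _ → refl) n) (mul1-cong {egf} (λ _ → refl) D-invFact n) ⟩
  mul1 (λ d → Δ^ d (Δ h) 0 * invFact d) invFact n + mul1 egf invFact n
    ≡⟨ cong₂ _+_ (newton (Δ h) n) (newton h n) ⟩
  (h (suc n) - h n) * invFact n + h n * invFact n
    ≡⟨ solve 3 (λ a b c → (a :- b) :* c :+ b :* c := a :* c) refl (h (suc n)) (h n) (invFact n) ⟩
  h (suc n) * invFact n
    ≡⟨ cong (h (suc n) *_) (D-invFact n) ⟨
  h (suc n) * (ι (suc n) * invFact (suc n))
    ≡⟨ swap (h (suc n)) (ι (suc n)) (invFact (suc n)) ⟩
  ι (suc n) * (h (suc n) * invFact (suc n))
    ∎)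
  where
  open ≡-Reasoning
  egf : Series1
  egf d = Δ^ d h 0 * invFact d
  swap : ∀ a b c → a * (b * c) ≡ b * (a * c)
  swap = solve 3 (λ a b c → a :* (b :* c) := b :* (a :* c)) refl
  D-egf : ∀ d → D egf d ≡ Δ^ d (Δ h) 0 * invFact d
  D-egf d = trans (swap (ι (suc d)) (Δ^ (suc d) h 0) (invFact (suc d))) (cong (Δ^ d (Δ h) 0 *_) (D-invFact d))

edgeWords : ℕ → ℕ → ℚ
edgeWords n t = ι ((t C 2) ℕ.^ n)

-- `expX` lives in degree 0 of `y`, so only the last term of the inner sum survives.
mul2-expX : ∀ A a b → mul2 A expX a b ≡ mul1 (λ i → A i b) invFact a
mul2-expX A a b = sumTo-cong a (λ {i} _ → last b i)
  where
  last : ∀ c i → sumTo (λ j → A i j * expX (a ∸ i) (c ∸ j)) c ≡ A i c * invFact (a ∸ i)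
  last zero    i = refl
  last (suc c) i = trans
    (cong₂ _+_
      (trans (sumTo-cong c (λ {j} j≤c → trans (cong (λ k → A i j * expX (a ∸ i) k) (ℕₚ.+-∸-assoc 1 j≤c)) (ℚₚ.*-zeroʳ (A i j)))) (sumTo-0 c))
      (cong (λ k → A i (suc c) * expX (a ∸ i) k) (ℕₚ.n∸n≡0 c)))
    (ℚₚ.+-identityˡ _)

-- The geometry enters only through the hypothesis on `fSigma`; the rest is compared degree by
-- degree in `y`. In degree 0 both sides are e^x, and in each positive degree the claim is Newton's
-- formula in `x`.
generatingFunction : (∀ i n → ι (fSigma i (suc n)) ≡ Δ^ (suc (suc i)) (edgeWords (suc n)) 0) →
  (a b : ℕ) → mul2 LHS expX a b ≡ FxExpY a b
generatingFunction f-vector a zero = begin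
  mul2 LHS expX a 0                                  ≡⟨ mul2-expX LHS a 0 ⟩
  mul1 (λ i → LHS i 0) invFact a                     ≡⟨ constant a ⟩
  invFact a                                          ≡⟨ ℚₚ.*-identityʳ (invFact a) ⟨
  invFact a * 1ℚ                                     ≡⟨ cong (invFact a *_) (pow1-expY-0 (a C 2)) ⟨
  FxExpY a 0                                         ∎
  where
  open ≡-Reasoning
  LHS₀ : ∀ i → LHS (suc i) 0 ≡ 0ℚ
  LHS₀ zero    = refl
  LHS₀ (suc _) = refl
  constant : ∀ a → mul1 (λ i → LHS i 0) invFact a ≡ invFact a
  constant zero    = refl
  constant (suc a) = trans (sumTo-head _ a) (trans
    (cong₂ _+_ (ℚₚ.*-identityˡ (invFact (suc a)))
      (trans (sumTo-cong a (λ {j} _ → trans (cong (_* invFact (a ∸ j)) (LHS₀ j)) (ℚₚ.*-zeroˡ (invFact (a ∸ j))))) (sumTo-0 a)))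
    (ℚₚ.+-identityʳ _))
generatingFunction f-vector a (suc n) = begin
  mul2 LHS expX a (suc n)
    ≡⟨ mul2-expX LHS a (suc n) ⟩
  mul1 (λ i → LHS i (suc n)) invFact a
    ≡⟨ sumTo-cong a (λ {i} _ → trans (cong (_* invFact (a ∸ i)) (column i)) (pull (Δ^ i h 0) (invFact i) (invFact (suc n)) (invFact (a ∸ i)))) ⟩
  sumTo (λ i → invFact (suc n) * (Δ^ i h 0 * invFact i * invFact (a ∸ i))) a
    ≡⟨ sumTo-*ˡ (invFact (suc n)) _ a ⟨
  invFact (suc n) * mul1 (λ d → Δ^ d h 0 * invFact d) invFact a
    ≡⟨ cong (invFact (suc n) *_) (newton h a) ⟩
  invFact (suc n) * (h a * invFact a)
    ≡⟨ solve 3 (λ a b c → a :* (b :* c) := c :* (b :* a)) refl (invFact (suc n)) (h a) (invFact a) ⟩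
  invFact a * (h a * invFact (suc n))
    ≡⟨ cong (invFact a *_) (pow1-expY (a C 2) (suc n)) ⟨
  FxExpY a (suc n)
    ∎
  where
  open ≡-Reasoning
  h : ℕ → ℚ
  h = edgeWords (suc n)
  pull : ∀ a b c d → a * b * c * d ≡ c * (a * b * d)
  pull = solve 4 (λ a b c d → a :* b :* c :* d := c :* (a :* b :* d)) refl
  -- Serves the exponents 0 and 1 of `x` alike: both differences compute to 0, as 0 C 2 and 1 C 2
  -- are 0 and the power is positive, and both inverse factorials compute to 1.
  zero-column : 0ℚ ≡ 0ℚ * 1ℚ * invFact (suc n)
  zero-column = sym (trans (cong (_* invFact (suc n)) (ℚₚ.*-zeroˡ 1ℚ)) (ℚₚ.*-zeroˡ (invFact (suc n))))
  column : ∀ i → LHS i (suc n) ≡ Δ^ i h 0 * invFact i * invFact (suc n)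
  column zero          = zero-column
  column (suc zero)    = zero-column
  column (suc (suc i)) = cong (λ f → f * invFact (suc (suc i)) * invFact (suc n)) (f-vector i n)

-- Counting words by their support

bit : Bool → ℕ
bit b = if b then 1 else 0

# : {A : Set} → (A → Bool) → List A → ℕ
# q []       = 0
# q (x ∷ xs) = bit (q x) ℕ.+ # q xs

module _ {A : Set} where

  #-cong : {p q : A → Bool} → (∀ x → p x ≡ q x) → ∀ xs → # p xs ≡ # q xs
  #-cong eq []       = refl
  #-cong eq (x ∷ xs) = cong₂ (λ b n → bit b ℕ.+ n) (eq x) (#-cong eq xs)

  #-++ : (q : A → Bool) → ∀ xs ys → # q (xs ++ ys) ≡ # q xs ℕ.+ # q ys
  #-++ q []       ys = refl
  #-++ q (x ∷ xs) ys = trans (cong (bit (q x) ℕ.+_) (#-++ q xs ys)) (sym (ℕₚ.+-assoc (bit (q x)) (# q xs) (# q ys)))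

  #-map : {B : Set} (q : A → Bool) (f : B → A) → ∀ xs → # q (map f xs) ≡ # (q ∘ f) xs
  #-map q f []       = refl
  #-map q f (x ∷ xs) = cong (bit (q (f x)) ℕ.+_) (#-map q f xs)

  #-none : (xs : List A) → # (λ _ → false) xs ≡ 0
  #-none []       = refl
  #-none (x ∷ xs) = #-none xs

  #-split : {p q r : A → Bool} → (∀ x → bit (p x) ≡ bit (q x) ℕ.+ bit (r x)) → ∀ xs → # p xs ≡ # q xs ℕ.+ # r xs
  #-split eq []       = refl
  #-split {p} {q} {r} eq (x ∷ xs) = trans (cong₂ ℕ._+_ (eq x) (#-split eq xs))
    (+-interchange (bit (q x)) (bit (r x)) (# q xs) (# r xs))

-- Supports are predicates on all of ℕ, of which only the first `m` values are tested. Passing to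
-- the next block is then precomposition with `suc`, without any reindexing of finite types.
within : ∀ {m} → Vec Bool m → (ℕ → Bool) → Bool
within []          s = true
within (true  ∷ T) s = within T (s ∘ suc)
within (false ∷ T) s = not (s 0) ∧ within T (s ∘ suc)

covers : ℕ → (ℕ → Bool) → Bool
covers zero    s = true
covers (suc m) s = s 0 ∧ covers m (s ∘ suc)

weight : ∀ {m} → Vec Bool m → ℕ
weight []      = 0
weight (b ∷ T) = bit b ℕ.+ weight T

-- Stated in ℚ, where the difference is a genuine one; on ℕ it would be truncated.
#-difference : {A : Set} (p q r : A → Bool) → (∀ x → bit (p x) ≡ bit (q x) ℕ.+ bit (r x)) →
  ∀ xs → ι (# q xs) ≡ ι (# p xs) - ι (# r xs)
#-difference p q r eq xs = begin
  b            ≡⟨ solve 2 (λ b c → b := (b :+ c) :- c) refl b c ⟩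
  b + c - c    ≡⟨ cong (_- c) (ι-+ (# q xs) (# r xs)) ⟨
  ι (# q xs ℕ.+ # r xs) - c    ≡⟨ cong (λ k → ι k - c) (#-split {p = p} {q} {r} eq xs) ⟨
  ι (# p xs) - c    ∎
  where
  open ≡-Reasoning
  b = ι (# q xs)
  c = ι (# r xs)

-- Inclusion–exclusion over the support: splitting on whether 0 lies in the
-- support replaces h by its forward difference.
#-covers : ∀ m {A : Set} (xs : List A) (p : A → Bool) (s : A → ℕ → Bool) (h : ℕ → ℚ) →
  (∀ (T : Vec Bool m) → ι (# (λ x → p x ∧ within T (s x)) xs) ≡ h (weight T)) →
  ι (# (λ x → p x ∧ covers m (s x)) xs) ≡ Δ^ m h 0
#-covers zero    xs p s h number = number []
#-covers (suc m) xs p s h number = trans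
  (cong ι (#-cong (λ x → sym (Boolₚ.∧-assoc (p x) (s x 0) (covers m (s x ∘ suc)))) xs))
  (#-covers m xs (λ x → p x ∧ s x 0) (λ x → s x ∘ suc) (Δ h)
    (λ T → trans
      (#-difference (λ x → p x ∧ within T (s x ∘ suc)) (λ x → (p x ∧ s x 0) ∧ within T (s x ∘ suc))
        (λ x → p x ∧ not (s x 0) ∧ within T (s x ∘ suc)) (λ x → split (p x) (s x 0) (within T (s x ∘ suc))) xs)
      (cong₂ _-_ (number (true ∷ T)) (number (false ∷ T)))))
  where
  split : ∀ p b w → bit (p ∧ w) ≡ bit ((p ∧ b) ∧ w) ℕ.+ bit (p ∧ not b ∧ w)
  split false b     w = refl
  split true  true  w = sym (ℕₚ.+-identityʳ (bit w))
  split true  false w = refl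

vecs : ∀ {A : Set} n → List A → List (Vec A n)
vecs zero    xs = [ [] ]
vecs (suc n) xs = cartesianProductWith _∷_ xs (vecs n xs)

allᵛ : ∀ {A : Set} {n} → (A → Bool) → Vec A n → Bool
allᵛ q []      = true
allᵛ q (x ∷ v) = q x ∧ allᵛ q v

#-allᵛ : ∀ {A : Set} n (q : A → Bool) xs → # (allᵛ q) (vecs n xs) ≡ # q xs ℕ.^ n
#-allᵛ zero    q xs = refl
#-allᵛ (suc n) q xs = trans (product xs) (cong (# q xs ℕ.*_) (#-allᵛ n q xs))
  where
  scale : ∀ b ys → # (λ v → b ∧ allᵛ q v) ys ≡ bit b ℕ.* # (allᵛ q) ys
  scale true  ys = sym (ℕₚ.*-identityˡ _)
  scale false ys = #-none ys
  product : ∀ zs → # (allᵛ q) (cartesianProductWith _∷_ zs (vecs n xs)) ≡ # q zs ℕ.* # (allᵛ q) (vecs n xs)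
  product []       = refl
  product (z ∷ zs) = begin
    # (allᵛ q) (map (z ∷_) ys ++ cartesianProductWith _∷_ zs ys)
      ≡⟨ #-++ (allᵛ q) (map (z ∷_) ys) _ ⟩
    # (allᵛ q) (map (z ∷_) ys) ℕ.+ # (allᵛ q) (cartesianProductWith _∷_ zs ys)
      ≡⟨ cong₂ ℕ._+_ (trans (#-map (allᵛ q) (z ∷_) ys) (scale (q z) ys)) (product zs) ⟩
    bit (q z) ℕ.* # (allᵛ q) ys ℕ.+ # q zs ℕ.* # (allᵛ q) ys
      ≡⟨ ℕₚ.*-distribʳ-+ (# (allᵛ q) ys) (bit (q z)) (# q zs) ⟨
    # q (z ∷ zs) ℕ.* # (allᵛ q) ys
      ∎
    where
    open ≡-Reasoning
    ys = vecs n xs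

-- (p , r) with p ≤ r records the blocks of the first and of the last
-- occurrence of an element.
Letter : Set
Letter = ℕ × ℕ

-- Grouped as the loop at block 0, the letters from block 0 to a later block, and the letters
-- avoiding block 0. This follows the recursion of `within`, so the counts with and without loops
-- obey one common recursion.
letters : ℕ → List Letter
letters zero    = []
letters (suc m) = (0 , 0) ∷ map (λ r → 0 , suc r) (upTo m) ++ map (Product.map suc suc) (letters m)

support : Letter → ℕ → Bool
support (p , r) k = (k ≡ᵇ p) ∨ (k ≡ᵇ r)

supportᵛ : ∀ {n} → Vec Letter n → ℕ → Bool
supportᵛ []      k = false
supportᵛ (l ∷ w) k = support l k ∨ supportᵛ w k

nonLoop : Letter → Bool
nonLoop (p , r) = not (p ≡ᵇ r)

hasLoop : ∀ {n} → Vec Letter n → Bool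
hasLoop w = not (allᵛ nonLoop w)

good : ∀ {n} → ℕ → Vec Letter n → Bool
good m w = hasLoop w ∧ covers m (supportᵛ w)

within-∅ : ∀ {m} (T : Vec Bool m) → within T (λ _ → false) ≡ true
within-∅ []          = refl
within-∅ (true  ∷ T) = within-∅ T
within-∅ (false ∷ T) = within-∅ T

within-∨ : ∀ {m} (T : Vec Bool m) (s t : ℕ → Bool) → within T (λ k → s k ∨ t k) ≡ within T s ∧ within T t
within-∨ []          s t = refl
within-∨ (true  ∷ T) s t = within-∨ T (s ∘ suc) (t ∘ suc)
within-∨ (false ∷ T) s t with s 0 | t 0
... | true  | _     = refl
... | false | true  = sym (Boolₚ.∧-zeroʳ _)
... | false | false = within-∨ T (s ∘ suc) (t ∘ suc)

-- A union is contained in a set exactly when each part is. The condition on a word thus splits over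
-- its letters, and the count becomes an n-th power.
within-supportᵛ : ∀ {m n} (T : Vec Bool m) (w : Vec Letter n) → within T (supportᵛ w) ≡ allᵛ (within T ∘ support) w
within-supportᵛ T []      = within-∅ T
within-supportᵛ T (l ∷ w) = trans (within-∨ T (support l) (supportᵛ w)) (cong (within T (support l) ∧_) (within-supportᵛ T w))

allᵛ-∧ : ∀ {A : Set} {n} (p q : A → Bool) (v : Vec A n) → allᵛ p v ∧ allᵛ q v ≡ allᵛ (λ x → p x ∧ q x) v
allᵛ-∧ p q []      = refl
allᵛ-∧ p q (x ∷ v) with p x | q x
... | false | _     = refl
... | true  | false = Boolₚ.∧-zeroʳ _
... | true  | true  = allᵛ-∧ p q v

#-singletons : ∀ {m} (T : Vec Bool m) → # (λ r → within T (_≡ᵇ r)) (upTo m) ≡ weight T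
#-singletons []      = refl
#-singletons {suc m} (b ∷ T) = cong₂ ℕ._+_ (first b) (trans
    (trans (cong (# _) (sym (Listₚ.map-upTo suc m))) (#-map _ suc (upTo m)))
    (trans (#-cong (rest b) (upTo m)) (#-singletons T)))
  where
  first : ∀ b → bit (within (b ∷ T) (_≡ᵇ 0)) ≡ bit b
  first true  = cong bit (within-∅ T)
  first false = refl
  rest : ∀ b r → within (b ∷ T) (_≡ᵇ suc r) ≡ within T (_≡ᵇ r)
  rest true  r = refl
  rest false r = refl

[1+t]C2 : ∀ t → suc t C 2 ≡ t ℕ.+ t C 2
[1+t]C2 t = trans (sym (nCk+nC[k+1]≡[n+1]C[k+1] t 1)) (cong (ℕ._+ t C 2) (nC1≡n t))

#-letters : ∀ (q : Letter → Bool) {m} (b : Bool) (T : Vec Bool m) →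
  # (λ l → q l ∧ within (b ∷ T) (support l)) (letters (suc m))
    ≡ bit (q (0 , 0) ∧ b) ℕ.+ (# (λ r → q (0 , suc r) ∧ b ∧ within T (_≡ᵇ r)) (upTo m)
                          ℕ.+ # (λ l → q (Product.map suc suc l) ∧ within T (support l)) (letters m))
#-letters q {m} b T = cong₂ ℕ._+_ (cong (λ c → bit (q (0 , 0) ∧ c)) (origin b)) (trans
  (#-++ _ (map (λ r → 0 , suc r) (upTo m)) (map (Product.map suc suc) (letters m)))
  (cong₂ ℕ._+_
    (trans (#-map _ (λ r → 0 , suc r) (upTo m)) (#-cong (λ r → cong (q (0 , suc r) ∧_) (arc b r)) (upTo m)))
    (trans (#-map _ (Product.map suc suc) (letters m)) (#-cong (λ l → cong (q (Product.map suc suc l) ∧_) (shift b l)) (letters m)))))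
  where
  origin : ∀ b → within (b ∷ T) (support (0 , 0)) ≡ b
  origin true  = within-∅ T
  origin false = refl
  arc : ∀ b r → within (b ∷ T) (support (0 , suc r)) ≡ b ∧ within T (_≡ᵇ r)
  arc true  r = refl
  arc false r = refl
  shift : ∀ b l → within (b ∷ T) (support (Product.map suc suc l)) ≡ within T (support l)
  shift true  l = refl
  shift false l = refl

#-allLetters : ∀ {m} (T : Vec Bool m) → # (within T ∘ support) (letters m) ≡ suc (weight T) C 2
#-allLetters []      = refl
#-allLetters {suc m} (b ∷ T) = trans (#-letters (λ _ → true) b T) (step b)
  where
  step : ∀ b → bit b ℕ.+ (# (λ r → b ∧ within T (_≡ᵇ r)) (upTo m) ℕ.+ # (within T ∘ support) (letters m))
             ≡ suc (bit b ℕ.+ weight T) C 2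
  -- A newly permitted block brings its own loop and one letter with each of the `weight T` others:
  -- Pascal's rule for two-element multisets.
  step true  = trans (cong suc (cong₂ ℕ._+_ (#-singletons T) (#-allLetters T))) (sym ([1+t]C2 (suc (weight T))))
  step false = cong₂ ℕ._+_ (#-none (upTo m)) (#-allLetters T)

#-nonLoops : ∀ {m} (T : Vec Bool m) → # (λ l → nonLoop l ∧ within T (support l)) (letters m) ≡ weight T C 2
#-nonLoops []      = refl
#-nonLoops {suc m} (b ∷ T) = trans (#-letters nonLoop b T) (step b)
  where
  step : ∀ b → # (λ r → b ∧ within T (_≡ᵇ r)) (upTo m) ℕ.+ # (λ l → nonLoop l ∧ within T (support l)) (letters m)
             ≡ (bit b ℕ.+ weight T) C 2
  step true  = trans (cong₂ ℕ._+_ (#-singletons T) (#-nonLoops T)) (sym ([1+t]C2 (weight T)))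
  step false = cong₂ ℕ._+_ (#-none (upTo m)) (#-nonLoops T)

#-good : ∀ n m → ι (# (good m) (vecs n (letters m))) ≡ Δ^ (suc m) (edgeWords n) 0
#-good n m = #-covers m (vecs n (letters m)) hasLoop supportᵛ (Δ (edgeWords n)) number
  where
  -- Requiring a loop already costs one difference, so inclusion-exclusion starts from
  -- `Δ (edgeWords n)`; `Δ^ m (Δ h)` is `Δ^ (suc m) h` by definition.
  number : (T : Vec Bool m) → ι (# (λ w → hasLoop w ∧ within T (supportᵛ w)) (vecs n (letters m))) ≡ Δ (edgeWords n) (weight T)
  number T = trans
    (#-difference (λ w → within T (supportᵛ w)) (λ w → hasLoop w ∧ within T (supportᵛ w))
      (λ w → allᵛ nonLoop w ∧ within T (supportᵛ w)) (λ w → split (allᵛ nonLoop w) (within T (supportᵛ w))) (vecs n (letters m)))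
    (cong₂ (λ a b → ι a - ι b)
      (trans (#-cong (within-supportᵛ T) (vecs n (letters m)))
        (trans (#-allᵛ n (within T ∘ support) (letters m)) (cong (ℕ._^ n) (#-allLetters T))))
      (trans (#-cong (λ w → trans (cong (allᵛ nonLoop w ∧_) (within-supportᵛ T w)) (allᵛ-∧ nonLoop (within T ∘ support) w)) (vecs n (letters m)))
        (trans (#-allᵛ n _ (letters m)) (cong (ℕ._^ n) (#-nonLoops T)))))
    where
    split : ∀ a b → bit b ≡ bit (not a ∧ b) ℕ.+ bit (a ∧ b)
    split true  b = refl
    split false b = sym (ℕₚ.+-identityʳ (bit b))

-- Words and chains of rays

T-ext : ∀ {a b} → (T a → T b) → (T b → T a) → a ≡ b
T-ext {true}  {true}  _ _ = refl
T-ext {true}  {false} f _ = ⊥-elim (f tt)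
T-ext {false} {true}  _ g = ⊥-elim (g tt)
T-ext {false} {false} _ _ = refl

T-not : ∀ {b} → ¬ T b → T (not b)
T-not {true}  ¬b = ⊥-elim (¬b tt)
T-not {false} ¬b = tt

T-not⁻ : ∀ {b} → T (not b) → ¬ T b
T-not⁻ {false} _ ()

Vec-ext : ∀ {A : Set} {n} {u v : Vec A n} → (∀ e → lookup u e ≡ lookup v e) → u ≡ v
Vec-ext {u = u} {v} eq = trans (sym (Vecₚ.tabulate∘lookup u)) (trans (Vecₚ.tabulate-cong eq) (Vecₚ.tabulate∘lookup v))

module _ {A : Set} where

  ↭-fromUnique : {xs ys : List A} → Unique xs → Unique ys → (∀ {z} → z ∈ xs → z ∈ ys) → (∀ {z} → z ∈ ys → z ∈ xs) → xs ↭ ys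
  ↭-fromUnique ux uy f g = ∼bag⇒↭ (unique∧set⇒bag ux uy (mk⇔ f g))

  #-↭ : (q : A → Bool) {xs ys : List A} → xs ↭ ys → # q xs ≡ # q ys
  #-↭ q Perm.refl         = refl
  #-↭ q (Perm.prep x p)   = cong (bit (q x) ℕ.+_) (#-↭ q p)
  #-↭ q {ys = _ ∷ _ ∷ ys} (Perm.swap x y p) = trans (cong (λ k → bit (q x) ℕ.+ (bit (q y) ℕ.+ k)) (#-↭ q p))
    (trans (sym (ℕₚ.+-assoc (bit (q x)) (bit (q y)) (# q ys)))
      (trans (cong (ℕ._+ # q ys) (ℕₚ.+-comm (bit (q x)) (bit (q y)))) (ℕₚ.+-assoc (bit (q y)) (bit (q x)) (# q ys))))
  #-↭ q (Perm.trans p p′) = trans (#-↭ q p) (#-↭ q p′)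

  length-filter-T : (q : A → Bool) → ∀ xs → length (filter (λ x → Bool.T? (q x)) xs) ≡ # q xs
  length-filter-T q []       = refl
  length-filter-T q (x ∷ xs) with q x
  ... | true  = cong suc (length-filter-T q xs)
  ... | false = length-filter-T q xs

  -- Injectivity is asked for on members only, because chains are shown to determine their words
  -- under admissibility.
  map-unique : {B : Set} (f : A → B) {xs : List A} → (∀ {x y} → x ∈ xs → y ∈ xs → f x ≡ f y → x ≡ y) → Unique xs → Unique (map f xs)
  map-unique f inj []         = []
  map-unique f inj (x∉ ∷ uxs) = All.tabulate distinct ∷ map-unique f (λ x∈ y∈ → inj (there x∈) (there y∈)) uxs
    where
    distinct : ∀ {z} → z ∈ map f _ → f _ ≢ z
    distinct z∈ fx≡z with ∈-map⁻ f z∈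
    ... | y , y∈ , refl = All.lookup x∉ y∈ (inj (here refl) (there y∈) fx≡z)

  map-≡-local : {B : Set} {f g : A → B} {xs : List A} → map f xs ≡ map g xs → ∀ {x} → x ∈ xs → f x ≡ g x
  map-≡-local eq (here refl) = Listₚ.∷-injectiveˡ eq
  map-≡-local eq (there x∈)  = map-≡-local (Listₚ.∷-injectiveʳ eq) x∈

  concatMap-map : {B C : Set} (f : A → B → C) → ∀ xs ys → concatMap (λ x → map (f x) ys) xs ≡ cartesianProductWith f xs ys
  concatMap-map f []       ys = refl
  concatMap-map f (x ∷ xs) ys = cong (map (f x) ys ++_) (concatMap-map f xs ys)

-- Subsets, rays and codes of ray sets

∈-subsets : ∀ {n} (S : Subset n) → S ∈ subsets n
∈-subsets []      = here refl
∈-subsets (b ∷ S) = ∈-concatMap⁺ _ (lose (∈-subsets S) (extend b))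
  where
  extend : ∀ b → (b ∷ S) ∈ (true ∷ S) ∷ (false ∷ S) ∷ []
  extend true  = here refl
  extend false = there (here refl)

subsets-unique : ∀ n → Unique (subsets n)
subsets-unique zero    = [] ∷ []
subsets-unique (suc n) = subst Unique (sym (concatMap-map (λ S b → b ∷ S) (subsets n) (true ∷ false ∷ [])))
  (Uniqueₚ.cartesianProductWith⁺ _ (λ eq → Vecₚ.∷-injectiveʳ eq , Vecₚ.∷-injectiveˡ eq)
    (subsets-unique n) (((λ ()) ∷ []) ∷ [] ∷ []))

∈-rayUniverse : ∀ {n} (r : Ray n) → r ∈ rayUniverse n
∈-rayUniverse {n} (S , S′) = subst ((S , S′) ∈_) (sym (concatMap-map _,_ (subsets n) (subsets n)))
  (∈-cartesianProductWith⁺ _,_ (∈-subsets S) (∈-subsets S′))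

rayUniverse-unique : ∀ n → Unique (rayUniverse n)
rayUniverse-unique n = subst Unique (sym (concatMap-map _,_ (subsets n) (subsets n)))
  (Uniqueₚ.cartesianProductWith⁺ _,_ (λ { refl → refl , refl }) (subsets-unique n) (subsets-unique n))

occurs : ∀ {n} → List (Ray n) → Ray n → Bool
occurs R r = any (λ r′ → does (r ≟Ray r′)) R

occurs⁺ : ∀ {n} {R : List (Ray n)} {r} → r ∈ R → T (occurs R r)
occurs⁺ {R = _ ∷ R} {r} (here refl) rewrite dec-true (r ≟Ray r) refl = tt
occurs⁺ {R = _ ∷ R} {r} (there r∈)  = from Boolₚ.T-∨ (inj₂ (occurs⁺ r∈))

occurs⁻ : ∀ {n} {R : List (Ray n)} {r} → T (occurs R r) → r ∈ R
occurs⁻ {R = r′ ∷ R} {r} t with r ≟Ray r′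
... | yes refl = here refl
... | no  _    = there (occurs⁻ t)

-- The universe lists every ray, so each membership can be read off at the position of that ray.
code-injective : ∀ {n} {R R′ : List (Ray n)} → code R ≡ code R′ → ∀ {r} → r ∈ R → r ∈ R′
code-injective {R = R} {R′} eq {r} r∈ =
  occurs⁻ (subst T (map-≡-local {f = occurs R} {occurs R′} eq (∈-rayUniverse r)) (occurs⁺ r∈))

-- Filtering the duplicate-free universe by membership in `R` returns `R` up to order. This is what
-- lets chains pass the cardinality filter of `iCones`.
card-code : ∀ {n} {R : List (Ray n)} → Unique R → card (code R) ≡ length R
card-code {n} {R} uR = begin
  length (filter Bool.T? (map (occurs R) (rayUniverse n)))      ≡⟨ length-filter-T (λ b → b) (map (occurs R) (rayUniverse n)) ⟩
  # (λ b → b) (map (occurs R) (rayUniverse n))                  ≡⟨ #-map (λ b → b) (occurs R) (rayUniverse n) ⟩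
  # (occurs R) (rayUniverse n)                                  ≡⟨ length-filter-T (occurs R) (rayUniverse n) ⟨
  length (filter (λ r → Bool.T? (occurs R r)) (rayUniverse n))  ≡⟨ ↭-length same ⟩
  length R                                                      ∎
  where
  open ≡-Reasoning
  present? = λ r → Bool.T? (occurs R r)
  same : filter present? (rayUniverse n) ↭ R
  same = ↭-fromUnique (Uniqueₚ.filter⁺ present? (rayUniverse-unique n)) uR
    (λ r∈ → occurs⁻ (proj₂ (∈-filter⁻ present? {xs = rayUniverse n} r∈)))
    (λ r∈ → ∈-filter⁺ present? (∈-rayUniverse _) (occurs⁺ r∈))

isFull⇒full : ∀ {n} (S : Subset n) → isFull S ≡ true → S ≡ full
isFull⇒full []         _  = refl
isFull⇒full (true ∷ S) eq = cong (true ∷_) (isFull⇒full S eq)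

-- Undoes `classN` on nonempty sets: among these only the full set is sent to `∅`.
openClass : ∀ {n} → Subset n → Subset n
openClass C = if does (Subsetₚ.nonempty? C) then C else full

openClass-classN : ∀ {n} {S : Subset n} → Nonempty S → openClass (classN S) ≡ S
openClass-classN {n} {S} ne with isFull S in eq
... | true  = trans (cong (λ b → if b then ∅ else full) (dec-false (Subsetₚ.nonempty? (∅ {n})) (λ (_ , e∈) → Subsetₚ.∉⊥ e∈)))
  (sym (isFull⇒full S eq))
... | false = cong (λ b → if b then S else full) (dec-true (Subsetₚ.nonempty? S) ne)

-- Words, their chains of rays, and admissibility

first last : ∀ {n} → Vec Letter n → Fin n → ℕ
first w e = proj₁ (lookup w e)
last  w e = proj₂ (lookup w e)

-- Cut `j` lies between blocks `j` and `j + 1`. The two sets collect the elements with an occurrence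
-- before it and after it, respectively.
initial final : ∀ {n} → Vec Letter n → ℕ → Subset n
initial w j = Vec.map (λ l → proj₁ l ≤ᵇ j) w
final   w j = Vec.map (λ l → j <ᵇ proj₂ l) w

module _ {n : ℕ} where

  ∈-mask⁺ : ∀ {A : Set} {q : A → Bool} {w : Vec A n} {e} → T (q (lookup w e)) → e ∈ₛ Vec.map q w
  ∈-mask⁺ {q = q} {w} {e} t = Vecₚ.lookup⇒[]= e _ (trans (Vecₚ.lookup-map e q w) (to Boolₚ.T-≡ t))

  ∈-mask⁻ : ∀ {A : Set} {q : A → Bool} {w : Vec A n} {e} → e ∈ₛ Vec.map q w → T (q (lookup w e))
  ∈-mask⁻ {q = q} {w} {e} e∈ = from Boolₚ.T-≡ (trans (sym (Vecₚ.lookup-map e q w)) (Vecₚ.[]=⇒lookup e∈))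

  ∈-initial⁺ : ∀ (w : Vec Letter n) {j e} → first w e ≤ j → e ∈ₛ initial w j
  ∈-initial⁺ w p≤j = ∈-mask⁺ {w = w} (ℕₚ.≤⇒≤ᵇ p≤j)

  ∈-initial⁻ : ∀ (w : Vec Letter n) {j e} → e ∈ₛ initial w j → first w e ≤ j
  ∈-initial⁻ w e∈ = ℕₚ.≤ᵇ⇒≤ _ _ (∈-mask⁻ {w = w} e∈)

  ∈-final⁺ : ∀ (w : Vec Letter n) {j e} → j < last w e → e ∈ₛ final w j
  ∈-final⁺ w j<r = ∈-mask⁺ {w = w} (ℕₚ.<⇒<ᵇ j<r)

  ∈-final⁻ : ∀ (w : Vec Letter n) {j e} → e ∈ₛ final w j → j < last w e
  ∈-final⁻ w e∈ = ℕₚ.<ᵇ⇒< _ _ (∈-mask⁻ {w = w} e∈)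

chainRay : ∀ {n} → Vec Letter n → ℕ → Ray n
chainRay w j = ray (initial w j) (final w j)

chain : ∀ {n} → ℕ → Vec Letter n → List (Ray n)
chain i w = map (chainRay w) (upTo i)

-- The propositional form of membership in `goodWords n i`. The blocks are 0 to `i`, one more than
-- there are cuts.
record Admissible {n} (i : ℕ) (w : Vec Letter n) : Set where
  field
    ordered  : ∀ e → first w e ≤ last w e
    bounded  : ∀ e → last w e ≤ i
    covering : ∀ {k} → k ≤ i → ∃ λ e → first w e ≡ k ⊎ last w e ≡ k
    loop     : ∃ λ e → first w e ≡ last w e

∈-vecs⁺ : ∀ {A : Set} {n} {xs : List A} (w : Vec A n) → (∀ e → lookup w e ∈ xs) → w ∈ vecs n xs
∈-vecs⁺ []      _    = here refl
∈-vecs⁺ (x ∷ w) each = ∈-cartesianProductWith⁺ _∷_ (each Fin.zero) (∈-vecs⁺ w (each ∘ Fin.suc))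

∈-vecs⁻ : ∀ {A : Set} {n} {xs : List A} {w : Vec A n} → w ∈ vecs n xs → ∀ e → lookup w e ∈ xs
∈-vecs⁻ {n = suc n} {xs} w∈ e with ∈-cartesianProductWith⁻ _∷_ xs (vecs n xs) w∈
∈-vecs⁻ w∈ Fin.zero    | _ , _ , x∈ , _  , refl = x∈
∈-vecs⁻ w∈ (Fin.suc e) | _ , _ , _  , v∈ , refl = ∈-vecs⁻ v∈ e

vecs-unique : ∀ {A : Set} n {xs : List A} → Unique xs → Unique (vecs n xs)
vecs-unique zero    uxs = [] ∷ []
vecs-unique (suc n) uxs = Uniqueₚ.cartesianProductWith⁺ _∷_ Vecₚ.∷-injective uxs (vecs-unique n uxs)

∈-letters⁺ : ∀ {m p r} → p ≤ r → r < m → (p , r) ∈ letters m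
∈-letters⁺ {suc m} {zero}  {zero}  _ _ = here refl
∈-letters⁺ {suc m} {zero}  {suc r} _ (s≤s r<m) = there (∈-++⁺ˡ (∈-map⁺ (λ r → 0 , suc r) (∈-upTo⁺ r<m)))
∈-letters⁺ {suc m} {suc p} {suc r} (s≤s p≤r) (s≤s r<m) =
  there (∈-++⁺ʳ (map (λ r → 0 , suc r) (upTo m)) (∈-map⁺ (Product.map suc suc) (∈-letters⁺ p≤r r<m)))

∈-letters⁻ : ∀ {m p r} → (p , r) ∈ letters m → p ≤ r × r < m
∈-letters⁻ {suc m} (here refl) = z≤n , s≤s z≤n
∈-letters⁻ {suc m} (there l∈) with ∈-++⁻ (map (λ r → 0 , suc r) (upTo m)) l∈
... | inj₁ l∈′ with ∈-map⁻ (λ r → 0 , suc r) l∈′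
...   | r , r∈ , refl = z≤n , s≤s (∈-upTo⁻ r∈)
∈-letters⁻ {suc m} (there l∈) | inj₂ l∈′ with ∈-map⁻ (Product.map suc suc) l∈′
...   | _ , l∈″ , refl = Product.map s≤s s≤s (∈-letters⁻ l∈″)

letters-unique : ∀ m → Unique (letters m)
letters-unique zero    = []
letters-unique (suc m) = All.tabulate nonzero ∷ Uniqueₚ.++⁺
  (Uniqueₚ.map⁺ (λ { refl → refl }) (Uniqueₚ.upTo⁺ m))
  (Uniqueₚ.map⁺ (λ { {_ , _} {_ , _} refl → refl }) (letters-unique m))
  (λ (l∈ , l∈′) → disjoint l∈ l∈′)
  where
  disjoint : ∀ {l} → l ∈ map (λ r → 0 , suc r) (upTo m) → ¬ l ∈ map (Product.map suc suc) (letters m)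
  disjoint l∈ l∈′ with ∈-map⁻ (λ r → 0 , suc r) l∈ | ∈-map⁻ (Product.map suc suc) l∈′
  ... | _ , _ , refl | _ , _ , ()
  nonzero : ∀ {l} → l ∈ map (λ r → 0 , suc r) (upTo m) ++ map (Product.map suc suc) (letters m) → (0 , 0) ≢ l
  nonzero l∈ refl with ∈-++⁻ (map (λ r → 0 , suc r) (upTo m)) l∈
  ... | inj₁ l∈′ with ∈-map⁻ (λ r → 0 , suc r) l∈′
  ...   | _ , _ , ()
  nonzero l∈ refl | inj₂ l∈′ with ∈-map⁻ (Product.map suc suc) l∈′
  ...   | _ , _ , ()

covers⁺ : ∀ m {s} → (∀ {k} → k < m → T (s k)) → T (covers m s)
covers⁺ zero    _   = tt
covers⁺ (suc m) all = from Boolₚ.T-∧ (all (s≤s z≤n) , covers⁺ m (all ∘ s≤s))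

covers⁻ : ∀ m {s} → T (covers m s) → ∀ {k} → k < m → T (s k)
covers⁻ (suc m) {s} t {zero}  _         = proj₁ (to (Boolₚ.T-∧ {s 0}) t)
covers⁻ (suc m) {s} t {suc k} (s≤s k<m) = covers⁻ m (proj₂ (to (Boolₚ.T-∧ {s 0}) t)) k<m

supportᵛ⁺ : ∀ {n} (w : Vec Letter n) {k} e → first w e ≡ k ⊎ last w e ≡ k → T (supportᵛ w k)
supportᵛ⁺ ((p , r) ∷ w) Fin.zero (inj₁ refl) = from Boolₚ.T-∨ (inj₁ (from Boolₚ.T-∨ (inj₁ (ℕₚ.≡⇒≡ᵇ p p refl))))
supportᵛ⁺ ((p , r) ∷ w) Fin.zero (inj₂ refl) = from (Boolₚ.T-∨ {_} {supportᵛ w r}) (inj₁ (from (Boolₚ.T-∨ {r ≡ᵇ p}) (inj₂ (ℕₚ.≡⇒≡ᵇ r r refl))))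
supportᵛ⁺ (l ∷ w) {k} (Fin.suc e) at = from (Boolₚ.T-∨ {support l k}) (inj₂ (supportᵛ⁺ w e at))

supportᵛ⁻ : ∀ {n} (w : Vec Letter n) {k} → T (supportᵛ w k) → ∃ λ e → first w e ≡ k ⊎ last w e ≡ k
supportᵛ⁻ ((p , r) ∷ w) {k} t with to (Boolₚ.T-∨ {support (p , r) k}) t
... | inj₂ t′ = Product.map Fin.suc (λ at → at) (supportᵛ⁻ w t′)
... | inj₁ t′ with to (Boolₚ.T-∨ {k ≡ᵇ p}) t′
...   | inj₁ eq = Fin.zero , inj₁ (sym (ℕₚ.≡ᵇ⇒≡ k p eq))
...   | inj₂ eq = Fin.zero , inj₂ (sym (ℕₚ.≡ᵇ⇒≡ k r eq))

hasLoop⁺ : ∀ {n} (w : Vec Letter n) e → first w e ≡ last w e → T (hasLoop w)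
hasLoop⁺ w e eq = T-not (λ t → contra w e eq t)
  where
  contra : ∀ {n} (w : Vec Letter n) e → first w e ≡ last w e → ¬ T (allᵛ nonLoop w)
  contra ((p , r) ∷ w) Fin.zero    eq t = T-not⁻ (proj₁ (to (Boolₚ.T-∧ {nonLoop (p , r)}) t)) (ℕₚ.≡⇒≡ᵇ p r eq)
  contra (l ∷ w)       (Fin.suc e) eq t = contra w e eq (proj₂ (to (Boolₚ.T-∧ {nonLoop l}) t))

hasLoop⁻ : ∀ {n} (w : Vec Letter n) → T (hasLoop w) → ∃ λ e → first w e ≡ last w e
hasLoop⁻ ((p , r) ∷ w) t with p ≡ᵇ r in eq
... | true  = Fin.zero , ℕₚ.≡ᵇ⇒≡ p r (subst T (sym eq) tt)
... | false = Product.map Fin.suc (λ at → at) (hasLoop⁻ w t)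

goodWords : (n i : ℕ) → List (Vec Letter n)
goodWords n i = filter (λ w → Bool.T? (good (suc i) w)) (vecs n (letters (suc i)))

∈-goodWords⁺ : ∀ {n i} {w : Vec Letter n} → Admissible i w → w ∈ goodWords n i
∈-goodWords⁺ {n} {i} {w} adm = ∈-filter⁺ (λ w → Bool.T? (good (suc i) w))
  (∈-vecs⁺ w (λ e → ∈-letters⁺ (ordered e) (s≤s (bounded e))))
  (from Boolₚ.T-∧ (hasLoop⁺ w (proj₁ loop) (proj₂ loop) ,
    covers⁺ (suc i) (λ { (s≤s k≤i) → supportᵛ⁺ w (proj₁ (covering k≤i)) (proj₂ (covering k≤i)) })))
  where open Admissible adm

∈-goodWords⁻ : ∀ {n i} {w : Vec Letter n} → w ∈ goodWords n i → Admissible i w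
∈-goodWords⁻ {n} {i} {w} w∈ with ∈-filter⁻ (λ w → Bool.T? (good (suc i) w)) {xs = vecs n (letters (suc i))} w∈
... | w∈vecs , t = record
  { ordered  = λ e → proj₁ (∈-letters⁻ {suc i} (∈-vecs⁻ w∈vecs e))
  ; bounded  = λ e → ℕₚ.≤-pred (proj₂ (∈-letters⁻ {suc i} (∈-vecs⁻ w∈vecs e)))
  ; covering = λ k≤i → supportᵛ⁻ w (covers⁻ (suc i) {supportᵛ w} (proj₂ (to (Boolₚ.T-∧ {hasLoop w}) t)) (s≤s k≤i))
  ; loop     = hasLoop⁻ w (proj₁ (to (Boolₚ.T-∧ {hasLoop w}) t))
  }

goodWords-unique : ∀ n i → Unique (goodWords n i)
goodWords-unique n i = Uniqueₚ.filter⁺ _ (vecs-unique n (letters-unique (suc i)))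

module _ {n i : ℕ} {w : Vec Letter n} (adm : Admissible i w) where
  open Admissible adm

  -- Block 0 is used. An element whose last occurrence is there also has its first one there, so in
  -- both cases it belongs to every initial set.
  initial-nonempty : ∀ j → Nonempty (initial w j)
  initial-nonempty j with covering z≤n
  ... | e , inj₁ p≡0 = e , ∈-initial⁺ w (subst (_≤ j) (sym p≡0) z≤n)
  ... | e , inj₂ r≡0 = e , ∈-initial⁺ w (ℕₚ.≤-trans (ordered e) (subst (_≤ j) (sym r≡0) z≤n))

  final-nonempty : ∀ {j} → j < i → Nonempty (final w j)
  final-nonempty {j} j<i with covering ℕₚ.≤-refl
  ... | e , inj₁ p≡i = e , ∈-final⁺ w (ℕₚ.<-≤-trans j<i (subst (_≤ last w e) p≡i (ordered e)))
  ... | e , inj₂ r≡i = e , ∈-final⁺ w (subst (j <_) (sym r≡i) j<i)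

  open-initial : ∀ j → openClass (proj₁ (chainRay w j)) ≡ initial w j
  open-initial j = openClass-classN (initial-nonempty j)

  open-final : ∀ {j} → j < i → openClass (proj₂ (chainRay w j)) ≡ final w j
  open-final j<i = openClass-classN (final-nonempty j<i)

  -- For a < b, block `b` is used by some element. If it first occurs there, it separates the
  -- initial sets of the two cuts; if it last occurs there, it separates the final sets.
  chain-unique : Unique (chain i w)
  chain-unique = subst Unique (sym (Listₚ.map-upTo (chainRay w) i)) (Uniqueₚ.applyUpTo⁺₁ (chainRay w) i distinct)
    where
    distinct : ∀ {a b} → a < b → b < i → chainRay w a ≢ chainRay w b
    distinct {a} {b} a<b b<i eq with covering (ℕₚ.<⇒≤ b<i)
    ... | e , inj₁ refl = ℕₚ.<⇒≱ a<b (∈-initial⁻ w (subst (e ∈ₛ_) same (∈-initial⁺ w ℕₚ.≤-refl)))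
      where
      same : initial w b ≡ initial w a
      same = trans (sym (open-initial b)) (trans (cong (openClass ∘ proj₁) (sym eq)) (open-initial a))
    ... | e , inj₂ refl = ℕₚ.<-irrefl refl (∈-final⁻ w (subst (e ∈ₛ_) same (∈-final⁺ w a<b)))
      where
      same : final w a ≡ final w b
      same = trans (sym (open-final (ℕₚ.<-trans a<b b<i))) (trans (cong (openClass ∘ proj₂) eq) (open-final b<i))

#-below : ∀ {p i} → p ≤ i → # (_<ᵇ p) (upTo i) ≡ p
#-below {zero}  {i}     _         = #-none (upTo i)
#-below {suc p} {suc i} (s≤s p≤i) = cong suc (trans (cong (# (_<ᵇ suc p)) (sym (Listₚ.map-upTo suc i)))
  (trans (#-map (_<ᵇ suc p) suc (upTo i)) (#-below p≤i)))

#-cong-local : ∀ {A : Set} {p q : A → Bool} {xs} → (∀ {x} → x ∈ xs → p x ≡ q x) → # p xs ≡ # q xs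
#-cong-local {xs = []}     eq = refl
#-cong-local {xs = x ∷ xs} eq = cong₂ (λ b k → bit b ℕ.+ k) (eq (here refl)) (#-cong-local (eq ∘ there))

module _ {n : ℕ} (e : Fin n) where

  misses-initial : Ray n → Bool
  misses-initial r = not (lookup (openClass (proj₁ r)) e)

  meets-final : Ray n → Bool
  meets-final r = lookup (openClass (proj₂ r)) e

  -- Counting does not depend on the order of the rays, so the set of rays of a
  -- chain determines its word.
  first-count : ∀ {i w} → Admissible i w → first w e ≡ # misses-initial (chain i w)
  first-count {i} {w} adm = sym (begin
    # misses-initial (map (chainRay w) (upTo i))   ≡⟨ #-map misses-initial (chainRay w) (upTo i) ⟩
    # (misses-initial ∘ chainRay w) (upTo i)       ≡⟨ #-cong (λ j → trans (cong (λ S → not (lookup S e)) (open-initial adm j)) (flip j)) (upTo i) ⟩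
    # (_<ᵇ first w e) (upTo i)                     ≡⟨ #-below (ℕₚ.≤-trans (ordered e) (bounded e)) ⟩
    first w e                                      ∎)
    where
    open ≡-Reasoning
    open Admissible adm
    flip : ∀ j → not (lookup (initial w j) e) ≡ (j <ᵇ first w e)
    flip j = trans (cong not (Vecₚ.lookup-map e _ w)) (T-ext
      (λ t → ℕₚ.<⇒<ᵇ (ℕₚ.≰⇒> (T-not⁻ t ∘ ℕₚ.≤⇒≤ᵇ {first w e} {j})))
      (λ t → T-not (ℕₚ.<⇒≱ (ℕₚ.<ᵇ⇒< j (first w e) t) ∘ ℕₚ.≤ᵇ⇒≤ (first w e) j)))

  last-count : ∀ {i w} → Admissible i w → last w e ≡ # meets-final (chain i w)
  last-count {i} {w} adm = sym (begin
    # meets-final (map (chainRay w) (upTo i))   ≡⟨ #-map meets-final (chainRay w) (upTo i) ⟩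
    # (meets-final ∘ chainRay w) (upTo i)       ≡⟨ #-cong-local {xs = upTo i} (λ j∈ → trans (cong (λ S → lookup S e) (open-final adm (∈-upTo⁻ j∈))) (Vecₚ.lookup-map e _ w)) ⟩
    # (_<ᵇ last w e) (upTo i)                   ≡⟨ #-below (bounded e) ⟩
    last w e                                    ∎)
    where
    open ≡-Reasoning
    open Admissible adm

code-chain-injective : ∀ {n i} {u v : Vec Letter n} → Admissible i u → Admissible i v →
  code (chain i u) ≡ code (chain i v) → u ≡ v
code-chain-injective {n} {i} {u} {v} adm-u adm-v eq = Vec-ext λ e → cong₂ _,_
  (trans (first-count e adm-u) (trans (#-↭ (misses-initial e) same) (sym (first-count e adm-v))))
  (trans (last-count e adm-u) (trans (#-↭ (meets-final e) same) (sym (last-count e adm-v))))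
  where
  same : chain i u ↭ chain i v
  same = ↭-fromUnique (chain-unique adm-u) (chain-unique adm-v) (code-injective eq) (code-injective (sym eq))

-- From cones to words

module _ {n : ℕ} where

  ∈-setOf⁺ : ∀ {e : Fin n} {l} → e ∈ l → T (lookup (setOf l) e)
  ∈-setOf⁺ e∈ = from Boolₚ.T-≡ (Vecₚ.[]=⇒lookup (member e∈))
    where
    member : ∀ {e : Fin n} {l} → e ∈ l → e ∈ₛ setOf l
    member {l = x ∷ l} (here refl) = Subsetₚ.x∈p∪q⁺ {p = Subset.⁅ x ⁆} (inj₁ (Subsetₚ.x∈⁅x⁆ x))
    member {l = x ∷ l} (there e∈)  = Subsetₚ.x∈p∪q⁺ {p = Subset.⁅ x ⁆} (inj₂ (member e∈))

  ∈-setOf⁻ : ∀ {e : Fin n} {l} → T (lookup (setOf l) e) → e ∈ l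
  ∈-setOf⁻ {e} {l} t = member l (Vecₚ.lookup⇒[]= e _ (to Boolₚ.T-≡ t))
    where
    member : ∀ l {e : Fin n} → e ∈ₛ setOf l → e ∈ l
    member []      e∈ = ⊥-elim (Subsetₚ.∉⊥ e∈)
    member (x ∷ l) e∈ with Subsetₚ.x∈p∪q⁻ Subset.⁅ x ⁆ (setOf l) e∈
    ... | inj₁ e∈x = here (Subsetₚ.x∈⁅y⁆⇒x≡y x e∈x)
    ... | inj₂ e∈l = there (member l e∈l)

  count-++ : ∀ (e : Fin n) xs ys → count e (xs ++ ys) ≡ count e xs ℕ.+ count e ys
  count-++ e xs ys = trans (cong length (Listₚ.filter-++ (Fin._≟ e) xs ys)) (Listₚ.length-++ (filter (Fin._≟ e) xs))

  count⁺ : ∀ {e : Fin n} {l} → e ∈ l → 0 < count e l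
  count⁺ {e} e∈ = Listₚ.filter-some (Fin._≟ e) (Any.map sym e∈)

  count⁻ : ∀ {e : Fin n} l → 0 < count e l → e ∈ l
  count⁻ {e} (x ∷ l) 0< with x Fin.≟ e
  ... | yes x≡e = here (sym x≡e)
  ... | no  _   = there (count⁻ l 0<)

  count-here : ∀ (e : Fin n) l → count e (e ∷ l) ≡ suc (count e l)
  count-here e l = cong length (Listₚ.filter-accept (Fin._≟ e) refl)

module _ {A : Set} where

  take-mono : ∀ {m m′} {e : A} β → m ≤ m′ → e ∈ take m β → e ∈ take m′ β
  take-mono (x ∷ β) (s≤s m≤) (here eq)  = here eq
  take-mono (x ∷ β) (s≤s m≤) (there e∈) = there (take-mono β m≤ e∈)

  drop-anti : ∀ {m m′} {e : A} β → m ≤ m′ → e ∈ drop m′ β → e ∈ drop m β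
  drop-anti {m′ = m′} {e} β z≤n e∈ = subst (e ∈_) (Listₚ.take++drop≡id m′ β) (∈-++⁺ʳ (take m′ β) e∈)
  drop-anti (x ∷ β) (s≤s m≤) e∈ = drop-anti β m≤ e∈

  entry : ∀ {m} (β : List A) → m < length β → ∃ λ e → drop m β ≡ e ∷ drop (suc m) β × e ∈ take (suc m) β
  entry {zero}  (x ∷ β) _         = x , refl , here refl
  entry {suc m} (x ∷ β) (s≤s m<L) with entry β m<L
  ... | e , eq , e∈ = e , eq , there e∈

  #-length : (q : A → Bool) {xs : List A} → All (T ∘ q) xs → # q xs ≡ length xs
  #-length q []                = refl
  #-length q {x ∷ xs} (qx ∷ qxs) with q x
  ... | true = cong suc (#-length q qxs)

  #-zero : (q : A → Bool) {xs : List A} → All (¬_ ∘ T ∘ q) xs → # q xs ≡ 0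
  #-zero q []                  = refl
  #-zero q {x ∷ xs} (qx ∷ qxs) with q x
  ... | true  = ⊥-elim (qx tt)
  ... | false = #-zero q qxs

  #-bound : (q : A → Bool) → ∀ xs → # q xs ≤ length xs
  #-bound q []       = z≤n
  #-bound q (x ∷ xs) with q x
  ... | true  = s≤s (#-bound q xs)
  ... | false = ℕₚ.m≤n⇒m≤1+n (#-bound q xs)

  #-mono : {p q : A → Bool} → (∀ x → T (p x) → T (q x)) → ∀ xs → # p xs ≤ # q xs
  #-mono p⇒q []       = z≤n
  #-mono {p} {q} p⇒q (x ∷ xs) = ℕₚ.+-mono-≤ (bit-mono (p x) (q x) (p⇒q x)) (#-mono p⇒q xs)
    where
    bit-mono : ∀ a b → (T a → T b) → bit a ≤ bit b
    bit-mono false _     _ = z≤n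
    bit-mono true  true  _ = s≤s z≤n
    bit-mono true  false f = ⊥-elim (f tt)

  map-upTo-lookup : {B : Set} (f : ℕ → B) (g : A → B) (xs : List A) →
    (∀ k → f (toℕ k) ≡ g (List.lookup xs k)) → map f (upTo (length xs)) ≡ map g xs
  map-upTo-lookup f g []       eq = refl
  map-upTo-lookup f g (x ∷ xs) eq = cong₂ _∷_ (eq Fin.zero) (begin
    map f (applyUpTo suc (length xs))     ≡⟨ cong (map f) (Listₚ.map-upTo suc (length xs)) ⟨
    map f (map suc (upTo (length xs)))    ≡⟨ Listₚ.map-∘ (upTo (length xs)) ⟨
    map (f ∘ suc) (upTo (length xs))      ≡⟨ map-upTo-lookup (f ∘ suc) g xs (eq ∘ Fin.suc) ⟩
    map g xs                              ∎)
    where open ≡-Reasoning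

  -- Turns a choice of rays into a choice of cut positions, for which order and range make sense.
  choose-map : {B : Set} (f : A → B) → ∀ i xs → choose i (map f xs) ≡ map (map f) (choose i xs)
  choose-map f zero    xs       = refl
  choose-map f (suc i) []       = refl
  choose-map f (suc i) (x ∷ xs) = begin
    map (f x ∷_) (choose i (map f xs)) ++ choose (suc i) (map f xs)
      ≡⟨ cong₂ (λ a b → map (f x ∷_) a ++ b) (choose-map f i xs) (choose-map f (suc i) xs) ⟩
    map (f x ∷_) (map (map f) (choose i xs)) ++ map (map f) (choose (suc i) xs)
      ≡⟨ cong (_++ map (map f) (choose (suc i) xs)) (trans (sym (Listₚ.map-∘ (choose i xs))) (Listₚ.map-∘ (choose i xs))) ⟩
    map (map f) (map (x ∷_) (choose i xs)) ++ map (map f) (choose (suc i) xs)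
      ≡⟨ Listₚ.map-++ (map f) (map (x ∷_) (choose i xs)) (choose (suc i) xs) ⟨
    map (map f) (map (x ∷_) (choose i xs) ++ choose (suc i) xs)
      ∎
    where open ≡-Reasoning

  choose-length : ∀ i (xs : List A) {ys} → ys ∈ choose i xs → length ys ≡ i
  choose-length zero    xs       (here refl) = refl
  choose-length (suc i) (x ∷ xs) ys∈ with ∈-++⁻ (map (x ∷_) (choose i xs)) ys∈
  ... | inj₂ ys∈′ = choose-length (suc i) xs ys∈′
  ... | inj₁ ys∈′ with ∈-map⁻ (x ∷_) ys∈′
  ...   | zs , zs∈ , refl = cong suc (choose-length i xs zs∈)

  choose-⊆ : ∀ i (xs : List A) {ys} → ys ∈ choose i xs → ∀ {y} → y ∈ ys → y ∈ xs
  choose-⊆ zero    xs       (here refl) ()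
  choose-⊆ (suc i) (x ∷ xs) ys∈ y∈ with ∈-++⁻ (map (x ∷_) (choose i xs)) ys∈
  ... | inj₂ ys∈′ = there (choose-⊆ (suc i) xs ys∈′ y∈)
  ... | inj₁ ys∈′ with ∈-map⁻ (x ∷_) ys∈′
  choose-⊆ (suc i) (x ∷ xs) ys∈ (here eq)  | inj₁ _ | zs , zs∈ , refl = here eq
  choose-⊆ (suc i) (x ∷ xs) ys∈ (there y∈) | inj₁ _ | zs , zs∈ , refl = there (choose-⊆ i xs zs∈ y∈)

  choose-allPairs : {R : A → A → Set} → ∀ i {xs : List A} {ys} → AllPairs R xs → ys ∈ choose i xs → AllPairs R ys
  choose-allPairs zero    Rxs (here refl) = []
  choose-allPairs (suc i) {x ∷ xs} (Rx ∷ Rxs) ys∈ with ∈-++⁻ (map (x ∷_) (choose i xs)) ys∈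
  ... | inj₂ ys∈′ = choose-allPairs (suc i) Rxs ys∈′
  ... | inj₁ ys∈′ with ∈-map⁻ (x ∷_) ys∈′
  ...   | zs , zs∈ , refl = All.tabulate (λ z∈ → All.lookup Rx (choose-⊆ i xs zs∈ z∈)) ∷ choose-allPairs i Rxs zs∈

-- Along an ascending list such a `q` holds on an initial segment, whose length is the count.
-- Comparing an index with a count therefore recovers the value of `q` at each cut.
threshold : ∀ {q : ℕ → Bool} {ms} → (∀ {m m′} → m ≤ m′ → T (q m′) → T (q m)) → AllPairs _<_ ms →
  ∀ k → q (List.lookup ms k) ≡ (toℕ k <ᵇ # q ms)
threshold {q} {m ∷ ms} anti (m< ∷ asc) k with q m in eq
threshold {q} {m ∷ ms} anti (m< ∷ asc) Fin.zero    | true  = eq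
threshold {q} {m ∷ ms} anti (m< ∷ asc) (Fin.suc k) | true  = threshold anti asc k
threshold {q} {m ∷ ms} anti (m< ∷ asc) k           | false = trans (all-false k)
  (cong (toℕ k <ᵇ_) (sym (#-zero q (All.map false-from m<))))
  where
  false-from : ∀ {m′} → m < m′ → ¬ T (q m′)
  false-from m<m′ t = subst T eq (anti (ℕₚ.<⇒≤ m<m′) t)
  all-false : ∀ k → q (List.lookup (m ∷ ms) k) ≡ false
  all-false Fin.zero    = eq
  all-false (Fin.suc k) = T-ext (false-from (All.lookup m< (∈-lookup k))) (λ ())

-- Block `k` occupies the positions from `lo` to `hi`. These are neighbouring cuts, with `a` and `L`
-- as the outer boundaries when there is no cut on that side.
record Split (a L k : ℕ) (ms : List ℕ) : Set where
  field
    ms₁ ms₂ : List ℕ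
    lo hi   : ℕ
    ms-≡    : ms ≡ ms₁ ++ ms₂
    length₁ : length ms₁ ≡ k
    below   : All (_≤ lo) ms₁
    above   : All (hi ≤_) ms₂
    a≤lo    : a ≤ lo
    lo<hi   : lo < hi
    hi≤L    : hi ≤ L

-- The left boundary is arbitrary so that the induction can continue to the right of the first cut.
split : ∀ {a L k ms} → a < L → All (λ m → a < m × m < L) ms → AllPairs _<_ ms → k ≤ length ms → Split a L k ms
split {a} {L} {zero} {[]} a<L _ _ _ = record
  { ms₁ = [] ; ms₂ = [] ; lo = a ; hi = L ; ms-≡ = refl ; length₁ = refl
  ; below = [] ; above = [] ; a≤lo = ℕₚ.≤-refl ; lo<hi = a<L ; hi≤L = ℕₚ.≤-refl }
split {a} {L} {zero} {m ∷ ms} a<L ((a<m , m<L) ∷ _) (m< ∷ _) _ = record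
  { ms₁ = [] ; ms₂ = m ∷ ms ; lo = a ; hi = m ; ms-≡ = refl ; length₁ = refl
  ; below = [] ; above = ℕₚ.≤-refl ∷ All.map ℕₚ.<⇒≤ m< ; a≤lo = ℕₚ.≤-refl ; lo<hi = a<m ; hi≤L = ℕₚ.<⇒≤ m<L }
split {a} {L} {suc k} {m ∷ ms} a<L ((a<m , m<L) ∷ range) (m< ∷ asc) (s≤s k≤) = record
  { ms₁ = m ∷ ms₁ ; ms₂ = ms₂ ; lo = lo ; hi = hi ; ms-≡ = cong (m ∷_) ms-≡ ; length₁ = cong suc length₁
  ; below = a≤lo ∷ below ; above = above ; a≤lo = ℕₚ.≤-trans (ℕₚ.<⇒≤ a<m) a≤lo ; lo<hi = lo<hi ; hi≤L = hi≤L }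
  where
  open Split (split {m} {L} {k} m<L (All.zipWith (λ (m<m′ , (_ , m′<L)) → m<m′ , m′<L) (m< , range)) asc k≤)

cutRay : ∀ {n} → List (Fin n) → ℕ → Ray n
cutRay β m = ray (setOf (take m β)) (setOf (drop m β))

module Cuts {n : ℕ} (β : List (Fin n)) (ms : List ℕ)
  (0<L : 0 < length β)
  (once : ∀ e → 0 < count e β)
  (twice : ∀ e → count e β ≤ 2)
  (single : ∃ λ e → count e β ≡ 1)
  (range : All (λ m → 0 < m × m < length β) ms)
  (asc : AllPairs _<_ ms) where

  before after : Fin n → ℕ → Bool
  before e m = not (lookup (setOf (take m β)) e)
  after  e m = lookup (setOf (drop m β)) e

  before⁺ : ∀ {e m} → ¬ e ∈ take m β → T (before e m)
  before⁺ e∉ = T-not (e∉ ∘ ∈-setOf⁻)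

  before⁻ : ∀ {e m} → T (before e m) → ¬ e ∈ take m β
  before⁻ t e∈ = T-not⁻ t (∈-setOf⁺ e∈)

  before-anti : ∀ e {m m′} → m ≤ m′ → T (before e m′) → T (before e m)
  before-anti e m≤m′ t = before⁺ (before⁻ t ∘ take-mono β m≤m′)

  after-anti : ∀ e {m m′} → m ≤ m′ → T (after e m′) → T (after e m)
  after-anti e m≤m′ t = ∈-setOf⁺ (drop-anti β m≤m′ (∈-setOf⁻ t))

  count-split : ∀ e m → count e β ≡ count e (take m β) ℕ.+ count e (drop m β)
  count-split e m = trans (cong (count e) (sym (Listₚ.take++drop≡id m β))) (count-++ e (take m β) (drop m β))

  before⇒after : ∀ e m → T (before e m) → T (after e m)
  before⇒after e m t with ∈-++⁻ (take m β) (subst (e ∈_) (sym (Listₚ.take++drop≡id m β)) (count⁻ β (once e)))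
  ... | inj₁ e∈ = ⊥-elim (before⁻ t e∈)
  ... | inj₂ e∈ = ∈-setOf⁺ e∈

  -- The index of the block containing an occurrence is the number of cuts to the left of it. For
  -- the first occurrence these are the cuts before which the element is absent; for the last, the
  -- cuts after which it is still present.
  word : Vec Letter n
  word = Vec.tabulate (λ e → # (before e) ms , # (after e) ms)

  first-word : ∀ e → first word e ≡ # (before e) ms
  first-word e = cong proj₁ (Vecₚ.lookup∘tabulate _ e)

  last-word : ∀ e → last word e ≡ # (after e) ms
  last-word e = cong proj₂ (Vecₚ.lookup∘tabulate _ e)

  initial-word : ∀ k → initial word (toℕ k) ≡ setOf (take (List.lookup ms k) β)
  initial-word k = Vec-ext λ e → begin
    lookup (initial word (toℕ k)) e           ≡⟨ Vecₚ.lookup-map e _ word ⟩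
    (first word e ≤ᵇ toℕ k)                   ≡⟨ cong (_≤ᵇ toℕ k) (first-word e) ⟩
    (# (before e) ms ≤ᵇ toℕ k)                ≡⟨ T-ext {# (before e) ms ≤ᵇ toℕ k}
                                                   (λ t → T-not (ℕₚ.≤⇒≯ (ℕₚ.≤ᵇ⇒≤ (# (before e) ms) (toℕ k) t) ∘ ℕₚ.<ᵇ⇒< (toℕ k) (# (before e) ms)))
                                                   (λ t → ℕₚ.≤⇒≤ᵇ (ℕₚ.≮⇒≥ (T-not⁻ t ∘ ℕₚ.<⇒<ᵇ {toℕ k} {# (before e) ms}))) ⟩
    not (toℕ k <ᵇ # (before e) ms)            ≡⟨ cong not (threshold (before-anti e) asc k) ⟨
    not (before e (List.lookup ms k))         ≡⟨ Boolₚ.not-involutive _ ⟩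
    lookup (setOf (take (List.lookup ms k) β)) e  ∎
    where open ≡-Reasoning

  final-word : ∀ k → final word (toℕ k) ≡ setOf (drop (List.lookup ms k) β)
  final-word k = Vec-ext λ e → begin
    lookup (final word (toℕ k)) e             ≡⟨ Vecₚ.lookup-map e _ word ⟩
    (toℕ k <ᵇ last word e)                    ≡⟨ cong (toℕ k <ᵇ_) (last-word e) ⟩
    (toℕ k <ᵇ # (after e) ms)                 ≡⟨ threshold (after-anti e) asc k ⟨
    after e (List.lookup ms k)                ∎
    where open ≡-Reasoning

  chain-word : chain (length ms) word ≡ map (cutRay β) ms
  chain-word = map-upTo-lookup (chainRay word) (cutRay β) ms (λ k → cong₂ ray (initial-word k) (final-word k))

  -- Together with the occurrence at position `lo` there would be three.
  not-straddling : ∀ {e lo hi} → drop lo β ≡ e ∷ drop (suc lo) β → lo < hi → e ∈ take lo β → ¬ e ∈ drop hi β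
  not-straddling {e} {lo} drop≡ lo<hi e∈take e∈drop = ℕₚ.<⇒≱ thrice (twice e)
    where
    thrice : 2 < count e β
    thrice = subst (3 ≤_) (sym (trans (count-split e lo)
        (cong (count e (take lo β) ℕ.+_) (trans (cong (count e) drop≡) (count-here e (drop (suc lo) β))))))
      (ℕₚ.+-mono-≤ (count⁺ e∈take) (s≤s (count⁺ (drop-anti β lo<hi e∈drop))))

  -- Monotonicity carries truth from `lo` to all of `ms₁` and failure from `hi` to all of `ms₂`, and
  -- `ms₁` has `k` entries.
  level : ∀ {q : ℕ → Bool} {k} (s : Split 0 (length β) k ms) → (∀ {m m′} → m ≤ m′ → T (q m′) → T (q m)) →
    (0 < Split.lo s → T (q (Split.lo s))) → (Split.hi s < length β → ¬ T (q (Split.hi s))) → # q ms ≡ k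
  level {q} {k} s anti q-lo ¬q-hi = begin
    # q ms                       ≡⟨ cong (# q) ms-≡ ⟩
    # q (ms₁ ++ ms₂)             ≡⟨ #-++ q ms₁ ms₂ ⟩
    # q ms₁ ℕ.+ # q ms₂          ≡⟨ cong₂ ℕ._+_ (#-length q (All.tabulate holds)) (#-zero q (All.tabulate fails)) ⟩
    length ms₁ ℕ.+ 0             ≡⟨ ℕₚ.+-identityʳ (length ms₁) ⟩
    length ms₁                   ≡⟨ length₁ ⟩
    k                            ∎
    where
    open ≡-Reasoning
    open Split s
    holds : ∀ {m} → m ∈ ms₁ → T (q m)
    holds {m} m∈ = anti m≤lo (q-lo (ℕₚ.<-≤-trans (proj₁ (All.lookup range (subst (m ∈_) (sym ms-≡) (∈-++⁺ˡ m∈)))) m≤lo))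
      where m≤lo = All.lookup below m∈
    fails : ∀ {m} → m ∈ ms₂ → ¬ T (q m)
    fails {m} m∈ t = ¬q-hi (ℕₚ.≤-<-trans hi≤m (proj₂ (All.lookup range (subst (m ∈_) (sym ms-≡) (∈-++⁺ʳ ms₁ m∈))))) (anti hi≤m t)
      where hi≤m = All.lookup above m∈

  -- The witness is the entry at position `lo`, where block `k` starts. If the element is new there,
  -- this is its first occurrence; otherwise it is the second of at most two, hence the last.
  block-nonempty : ∀ {k} → k ≤ length ms → ∃ λ e → first word e ≡ k ⊎ last word e ≡ k
  block-nonempty {k} k≤ = e , at
    where
    s = split {0} {length β} {k} 0<L range asc k≤
    open Split s
    found = entry β (ℕₚ.<-≤-trans lo<hi hi≤L)
    e = proj₁ found
    drop≡ = proj₁ (proj₂ found)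
    at : first word e ≡ k ⊎ last word e ≡ k
    at with lookup (setOf (take lo β)) e in seen
    ... | false = inj₁ (trans (first-word e) (level s (before-anti e)
            (λ _ → subst (T ∘ not) (sym seen) tt)
            (λ _ t → before⁻ t (take-mono β lo<hi (proj₂ (proj₂ found))))))
    ... | true  = inj₂ (trans (last-word e) (level s (after-anti e)
            (λ _ → ∈-setOf⁺ (subst (e ∈_) (sym drop≡) (here refl)))
            (λ _ t → not-straddling drop≡ lo<hi (∈-setOf⁻ (subst T (sym seen) tt)) (∈-setOf⁻ t))))

  after⇒before : ∀ {e} → count e β ≡ 1 → ∀ m → T (after e m) → T (before e m)
  after⇒before {e} eq m t = before⁺ (λ e∈ → ℕₚ.<-irrefl (sym eq) (subst (1 <_) (sym (count-split e m))
    (ℕₚ.+-mono-≤ (count⁺ {l = take m β} e∈) (count⁺ {l = drop m β} (∈-setOf⁻ t)))))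

  word-admissible : Admissible (length ms) word
  word-admissible = record
    { ordered  = λ e → subst₂ _≤_ (sym (first-word e)) (sym (last-word e)) (#-mono (before⇒after e) ms)
    ; bounded  = λ e → subst (_≤ length ms) (sym (last-word e)) (#-bound (after e) ms)
    ; covering = block-nonempty
    -- The element occurring once lies on exactly one side of each cut, so its two counts agree.
    ; loop     = let (e , eq) = single in
        e , trans (first-word e) (trans (#-cong (λ m → T-ext (before⇒after e m) (after⇒before eq m)) ms) (sym (last-word e)))
    }

-- From words to cones

-- Between ascending lists, inclusion of members already makes one a subsequence of the other, and
-- `choose` enumerates subsequences.
choose⁺ : ∀ xs {ms} → AllPairs _<_ xs → AllPairs _<_ ms → (∀ {m} → m ∈ ms → m ∈ xs) → ms ∈ choose (length ms) xs
choose⁺ xs       {[]}     _          _            _  = here refl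
choose⁺ []       {m ∷ ms} _          _            ⊆xs with () ← ⊆xs (here refl)
choose⁺ (x ∷ xs) {m ∷ ms} (x< ∷ asc) (m< ∷ asc′) ⊆xs with ⊆xs (here refl)
... | here refl = ∈-++⁺ˡ (∈-map⁺ (x ∷_) (choose⁺ xs asc asc′ tail⊆))
  where
  tail⊆ : ∀ {m} → m ∈ ms → m ∈ xs
  tail⊆ m∈ with ⊆xs (there m∈)
  ... | here refl = ⊥-elim (ℕₚ.<-irrefl refl (All.lookup m< m∈))
  ... | there m∈′ = m∈′
... | there m∈xs = ∈-++⁺ʳ (map (x ∷_) (choose (length ms) xs)) (choose⁺ xs asc (m< ∷ asc′) all⊆)
  where
  x<all : ∀ {m′} → m′ ∈ m ∷ ms → x < m′
  x<all (here refl) = All.lookup x< m∈xs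
  x<all (there m′∈) = ℕₚ.<-trans (All.lookup x< m∈xs) (All.lookup m< m′∈)
  all⊆ : ∀ {m′} → m′ ∈ m ∷ ms → m′ ∈ xs
  all⊆ m′∈ with ⊆xs m′∈
  ... | here refl  = ⊥-elim (ℕₚ.<-irrefl refl (x<all m′∈))
  ... | there m′∈′ = m′∈′

module _ {A : Set} {q : A → Bool} where

  all⁺ : ∀ {xs} → (∀ {x} → x ∈ xs → T (q x)) → T (all q xs)
  all⁺ {[]}     _ = tt
  all⁺ {x ∷ xs} f = from Boolₚ.T-∧ (f (here refl) , all⁺ (f ∘ there))

  all⁻ : ∀ {xs} → T (all q xs) → ∀ {x} → x ∈ xs → T (q x)
  all⁻ {x ∷ xs} t (here refl) = proj₁ (to (Boolₚ.T-∧ {q x}) t)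
  all⁻ {x ∷ xs} t (there x∈)  = all⁻ (proj₂ (to (Boolₚ.T-∧ {q x}) t)) x∈

-- Bipermutations and their cut positions

∈-words : ∀ {n} (β : List (Fin n)) → β ∈ words n (length β)
∈-words []      = here refl
∈-words (e ∷ β) = ∈-concatMap⁺ _ (lose (∈-words β) (∈-map⁺ (_∷ β) (∈-allFin e)))

record Bipermutation {n} (β : List (Fin n)) : Set where
  field
    len    : length β ≡ 2 ℕ.* n ∸ 1
    counts : ∀ e → count e β ≡ 1 ⊎ count e β ≡ 2
    single : ∃ λ e → count e β ≡ 1 × (∀ e′ → count e′ β ≡ 1 → e′ ≡ e)

module _ {n} {β : List (Fin n)} where

  once? = λ (e : Fin n) → count e β ℕ.≟ 1

  ∈-bipermutations⁺ : Bipermutation β → β ∈ bipermutations n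
  ∈-bipermutations⁺ bip = ∈-filter⁺ (λ w → Bool.T? (isBipermutation n w))
    (subst (λ k → β ∈ words n k) len (∈-words β))
    (from Boolₚ.T-∧ (ℕₚ.≡⇒≡ᵇ _ _ len ,
      from Boolₚ.T-∧ (all⁺ {xs = allFin n} (λ {e} _ → count-ok e (counts e)) , ℕₚ.≡⇒≡ᵇ _ _ (↭-length one))))
    where
    open Bipermutation bip
    κ = proj₁ single
    count-ok : ∀ e → count e β ≡ 1 ⊎ count e β ≡ 2 → T ((count e β ≡ᵇ 1) ∨ (count e β ≡ᵇ 2))
    count-ok e (inj₁ eq) = from Boolₚ.T-∨ (inj₁ (ℕₚ.≡⇒≡ᵇ _ _ eq))
    count-ok e (inj₂ eq) = from (Boolₚ.T-∨ {count e β ≡ᵇ 1}) (inj₂ (ℕₚ.≡⇒≡ᵇ _ _ eq))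
    one : filter once? (allFin n) ↭ [ κ ]
    one = ↭-fromUnique (Uniqueₚ.filter⁺ once? (Uniqueₚ.allFin⁺ n)) ([] ∷ [])
      (λ {e} e∈ → here (proj₂ (proj₂ single) e (proj₂ (∈-filter⁻ once? {xs = allFin n} e∈))))
      (λ { (here refl) → ∈-filter⁺ once? (∈-allFin κ) (proj₁ (proj₂ single)) })

  ∈-bipermutations⁻ : β ∈ bipermutations n → length β ≡ 2 ℕ.* n ∸ 1 × (∀ e → count e β ≡ 1 ⊎ count e β ≡ 2) × ∃ λ e → count e β ≡ 1
  ∈-bipermutations⁻ β∈ with ∈-filter⁻ (λ w → Bool.T? (isBipermutation n w)) {xs = words n (2 ℕ.* n ∸ 1)} β∈
  ... | _ , t with to (Boolₚ.T-∧ {length β ≡ᵇ 2 ℕ.* n ∸ 1}) t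
  ...   | len , t′ with to (Boolₚ.T-∧ {all (λ i → (count i β ≡ᵇ 1) ∨ (count i β ≡ᵇ 2)) (allFin n)}) t′
  ...     | counts , one = ℕₚ.≡ᵇ⇒≡ _ _ len , count-is , single
    where
    count-is : ∀ e → count e β ≡ 1 ⊎ count e β ≡ 2
    count-is e with to (Boolₚ.T-∨ {count e β ≡ᵇ 1}) (all⁻ counts (∈-allFin e))
    ... | inj₁ eq = inj₁ (ℕₚ.≡ᵇ⇒≡ _ _ eq)
    ... | inj₂ eq = inj₂ (ℕₚ.≡ᵇ⇒≡ _ _ eq)
    inhabited : (l : List (Fin n)) → T (length l ≡ᵇ 1) → ∃ λ e → e ∈ l
    inhabited (e ∷ _) _ = e , here refl
    single : ∃ λ e → count e β ≡ 1
    single with inhabited (filter once? (allFin n)) one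
    ... | e , e∈ = e , proj₂ (∈-filter⁻ once? {xs = allFin n} e∈)

positions : ℕ → List ℕ
positions n = map suc (upTo (2 ℕ.* n ∸ 2))

positions-ascending : ∀ n → AllPairs _<_ (positions n)
positions-ascending n = subst (AllPairs _<_) (sym (Listₚ.map-upTo suc (2 ℕ.* n ∸ 2)))
  (AllPairsₚ.applyUpTo⁺₁ suc (2 ℕ.* n ∸ 2) (λ i<j _ → s≤s i<j))

∈-positions⁺ : ∀ n {m} → 0 < m → m < 2 ℕ.* n ∸ 1 → m ∈ positions n
∈-positions⁺ n {suc m} _ m<L = ∈-map⁺ suc (∈-upTo⁺ (shift (2 ℕ.* n) m<L))
  where
  -- Subtraction is truncated, but the hypothesis forces `x` to be at least 2.
  shift : ∀ x → suc m < x ∸ 1 → m < x ∸ 2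
  shift (suc (suc x)) (s≤s m<x) = m<x

∈-positions⁻ : ∀ n {m} → m ∈ positions n → 0 < m × m < 2 ℕ.* n ∸ 1
∈-positions⁻ n m∈ with ∈-map⁻ suc m∈
... | k , k∈ , refl = s≤s z≤n , shift (2 ℕ.* n) (∈-upTo⁻ k∈)
  where
  shift : ∀ x → k < x ∸ 2 → suc k < x ∸ 1
  shift (suc (suc x)) k<x = s≤s k<x

-- The chosen rays come from cut positions `ms`. Their number is `length ms`, and `chain-word`
-- reproduces the rays one by one.
cone⇒word : ∀ {n} i {β : List (Fin n)} {R} → β ∈ bipermutations n → R ∈ choose i (raysOf n β) →
  ∃ λ w → w ∈ goodWords n i × code R ≡ code (chain i w)
cone⇒word {n} i {β} β∈ R∈ with ∈-map⁻ (map (cutRay β)) (subst (_ ∈_) (choose-map (cutRay β) i (positions n)) R∈)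
... | ms , ms∈ , refl with choose-length i (positions n) ms∈
...   | refl = word , ∈-goodWords⁺ word-admissible , cong code (sym chain-word)
  where
  facts = ∈-bipermutations⁻ β∈
  counts = proj₁ (proj₂ facts)
  single = proj₂ (proj₂ facts)
  1≤count : ∀ e → 0 < count e β
  1≤count e with counts e
  ... | inj₁ eq = subst (0 <_) (sym eq) (s≤s z≤n)
  ... | inj₂ eq = subst (0 <_) (sym eq) (s≤s z≤n)
  count≤2 : ∀ e → count e β ≤ 2
  count≤2 e with counts e
  ... | inj₁ eq = subst (_≤ 2) (sym eq) (s≤s z≤n)
  ... | inj₂ eq = ℕₚ.≤-reflexive eq
  open Cuts β ms (∈-length (count⁻ β (1≤count (proj₁ single)))) 1≤count count≤2 single
    (All.tabulate (λ m∈ → subst (λ L → _ × _ < L) (sym (proj₁ facts)) (∈-positions⁻ n (choose-⊆ i (positions n) ms∈ m∈))))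
    (choose-allPairs i (positions-ascending n) ms∈)

bit-<ᵇ-suc : ∀ x J → bit (x <ᵇ suc J) ≡ bit (x <ᵇ J) ℕ.+ bit (x ≡ᵇ J)
bit-<ᵇ-suc zero    zero    = refl
bit-<ᵇ-suc zero    (suc J) = refl
bit-<ᵇ-suc (suc x) zero    = refl
bit-<ᵇ-suc (suc x) (suc J) = bit-<ᵇ-suc x J

bit-<ᵇ-suc-∧ : ∀ x J o → bit ((x <ᵇ suc J) ∧ o) ≡ bit ((x <ᵇ J) ∧ o) ℕ.+ bit ((x ≡ᵇ J) ∧ o)
bit-<ᵇ-suc-∧ x J true
  rewrite Boolₚ.∧-identityʳ (x <ᵇ suc J) | Boolₚ.∧-identityʳ (x <ᵇ J) | Boolₚ.∧-identityʳ (x ≡ᵇ J) = bit-<ᵇ-suc x J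
bit-<ᵇ-suc-∧ x J false
  rewrite Boolₚ.∧-zeroʳ (x <ᵇ suc J) | Boolₚ.∧-zeroʳ (x <ᵇ J) | Boolₚ.∧-zeroʳ (x ≡ᵇ J) = refl

select : ∀ {n} → (Fin n → Bool) → List (Fin n)
select {n} q = filter (λ e → Bool.T? (q e)) (allFin n)

∈-select⁺ : ∀ {n} {q : Fin n → Bool} {e} → T (q e) → e ∈ select q
∈-select⁺ {q = q} t = ∈-filter⁺ (λ e → Bool.T? (q e)) (∈-allFin _) t

length-select : ∀ {n} (q : Fin n → Bool) → length (select q) ≡ # q (allFin n)
length-select {n} q = length-filter-T q (allFin n)

count-unique : ∀ {n} {e : Fin n} {l} → Unique l → e ∈ l → count e l ≡ 1
count-unique {e = e} {l} ul e∈ = ↭-length (↭-fromUnique (Uniqueₚ.filter⁺ (Fin._≟ e) ul) ([] ∷ [])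
  (λ e′∈ → here (proj₂ (∈-filter⁻ (Fin._≟ e) {xs = l} e′∈)))
  (λ { (here refl) → ∈-filter⁺ (Fin._≟ e) e∈ refl }))

count-select : ∀ {n} (e : Fin n) q → count e (select q) ≡ bit (q e)
count-select {n} e q with q e in eq
... | true  = count-unique (Uniqueₚ.filter⁺ _ (Uniqueₚ.allFin⁺ n)) (∈-select⁺ (subst T (sym eq) tt))
... | false with count e (select q) in c
...   | zero  = refl
...   | suc _ = ⊥-elim (subst T eq (proj₂ (∈-filter⁻ (λ e → Bool.T? (q e)) {xs = allFin n}
                  (count⁻ {e = e} (select q) (subst (0 <_) (sym c) (s≤s z≤n))))))

setOf-count⁺ : ∀ {n} {e : Fin n} l → 0 < count e l → T (lookup (setOf l) e)
setOf-count⁺ l 0< = ∈-setOf⁺ (count⁻ l 0<)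

setOf-count⁻ : ∀ {n} {e : Fin n} l → T (lookup (setOf l) e) → 0 < count e l
setOf-count⁻ l t = count⁺ {l = l} (∈-setOf⁻ t)

-- The bipermutation refining an admissible word: block j lists the elements
-- first occurring in it, then those last occurring in it; one loop κ is
-- listed only once.
module Refine {n i : ℕ} {w : Vec Letter n} (adm : Admissible i w) where
  open Admissible adm

  κ : Fin n
  κ = proj₁ loop

  other : Fin n → Bool
  other e = not (does (e Fin.≟ κ))

  block : ℕ → List (Fin n)
  block j = select (λ e → first w e ≡ᵇ j) ++ select (λ e → (last w e ≡ᵇ j) ∧ other e)

  prefix : ℕ → List (Fin n)
  prefix zero    = []
  prefix (suc J) = prefix J ++ block J

  β : List (Fin n)
  β = prefix (suc i)

  -- The contributions of the blocks telescope: each block adds the step from `x < J` to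
  -- `x < J + 1`, for the first and for the last occurrence.
  count-prefix : ∀ e J → count e (prefix J) ≡ bit (first w e <ᵇ J) ℕ.+ bit ((last w e <ᵇ J) ∧ other e)
  count-prefix e zero    = refl
  count-prefix e (suc J) = begin
    count e (prefix J ++ block J)
      ≡⟨ trans (count-++ e (prefix J) (block J)) (cong₂ ℕ._+_ (count-prefix e J)
           (trans (count-++ e (select _) (select _)) (cong₂ ℕ._+_ (count-select e _) (count-select e _)))) ⟩
    (a ℕ.+ b) ℕ.+ (c ℕ.+ d)
      ≡⟨ +-interchange a b c d ⟩
    (a ℕ.+ c) ℕ.+ (b ℕ.+ d)
      ≡⟨ cong₂ ℕ._+_ (bit-<ᵇ-suc (first w e) J) (bit-<ᵇ-suc-∧ (last w e) J (other e)) ⟨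
    bit (first w e <ᵇ suc J) ℕ.+ bit ((last w e <ᵇ suc J) ∧ other e)
      ∎
    where
    open ≡-Reasoning
    a = bit (first w e <ᵇ J)
    b = bit ((last w e <ᵇ J) ∧ other e)
    c = bit (first w e ≡ᵇ J)
    d = bit ((last w e ≡ᵇ J) ∧ other e)

  length-prefix : ∀ J → length (prefix J) ≡ # (λ e → first w e <ᵇ J) (allFin n) ℕ.+ # (λ e → (last w e <ᵇ J) ∧ other e) (allFin n)
  length-prefix zero    = sym (cong₂ ℕ._+_ (#-none (allFin n)) (#-none (allFin n)))
  length-prefix (suc J) = begin
    length (prefix J ++ block J)
      ≡⟨ trans (Listₚ.length-++ (prefix J)) (cong₂ ℕ._+_ (length-prefix J)
           (trans (Listₚ.length-++ (select (λ e → first w e ≡ᵇ J))) (cong₂ ℕ._+_ (length-select (λ e → first w e ≡ᵇ J)) (length-select (λ e → (last w e ≡ᵇ J) ∧ other e))))) ⟩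
    (a ℕ.+ b) ℕ.+ (c ℕ.+ d)
      ≡⟨ +-interchange a b c d ⟩
    (a ℕ.+ c) ℕ.+ (b ℕ.+ d)
      ≡⟨ cong₂ ℕ._+_
           (#-split {p = λ e → first w e <ᵇ suc J} (λ e → bit-<ᵇ-suc (first w e) J) (allFin n))
           (#-split {p = λ e → (last w e <ᵇ suc J) ∧ other e} (λ e → bit-<ᵇ-suc-∧ (last w e) J (other e)) (allFin n)) ⟨
    # (λ e → first w e <ᵇ suc J) (allFin n) ℕ.+ # (λ e → (last w e <ᵇ suc J) ∧ other e) (allFin n)
      ∎
    where
    open ≡-Reasoning
    a = # (λ e → first w e <ᵇ J) (allFin n)
    b = # (λ e → (last w e <ᵇ J) ∧ other e) (allFin n)
    c = # (λ e → first w e ≡ᵇ J) (allFin n)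
    d = # (λ e → (last w e ≡ᵇ J) ∧ other e) (allFin n)

  last< : ∀ e → (last w e <ᵇ suc i) ≡ true
  last< e = to Boolₚ.T-≡ (ℕₚ.<⇒<ᵇ (s≤s (bounded e)))

  first< : ∀ e → (first w e <ᵇ suc i) ≡ true
  first< e = to Boolₚ.T-≡ (ℕₚ.<⇒<ᵇ (s≤s (ℕₚ.≤-trans (ordered e) (bounded e))))

  count-β : ∀ e → count e β ≡ suc (bit (other e))
  count-β e = trans (count-prefix e (suc i)) (cong₂ (λ a b → bit a ℕ.+ bit (b ∧ other e)) (first< e) (last< e))

  -- Each of the `n` elements is listed as a first occurrence, and each except `κ` once more as a
  -- last one.
  length-β : length β ≡ 2 ℕ.* n ∸ 1
  length-β = begin
    length β                                 ≡⟨ length-prefix (suc i) ⟩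
    # _ (allFin n) ℕ.+ # _ (allFin n)        ≡⟨ cong₂ ℕ._+_ (trans (#-cong first< (allFin n)) all-n)
                                                  (#-cong (λ e → cong (_∧ other e) (last< e)) (allFin n)) ⟩
    n ℕ.+ # other (allFin n)                 ≡⟨ cong (λ k → n ℕ.+ (k ∸ 1)) (sym others) ⟩
    n ℕ.+ (n ∸ 1)                            ≡⟨ double κ ⟩
    2 ℕ.* n ∸ 1                              ∎
    where
    open ≡-Reasoning
    all-n : # (λ _ → true) (allFin n) ≡ n
    all-n = trans (#-length (λ _ → true) (All.universal (λ _ → tt) (allFin n))) (Listₚ.length-tabulate id)
    loops : # (λ e → does (e Fin.≟ κ)) (allFin n) ≡ 1
    loops = trans (count-κ (allFin n)) (count-unique (Uniqueₚ.allFin⁺ n) (∈-allFin κ))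
      where
      count-κ : ∀ l → # (λ e → does (e Fin.≟ κ)) l ≡ count κ l
      count-κ []      = refl
      count-κ (e ∷ l) with does (e Fin.≟ κ)
      ... | true  = cong suc (count-κ l)
      ... | false = count-κ l
    others : n ≡ suc (# other (allFin n))
    others = trans (sym all-n) (trans
      (#-split {q = λ e → does (e Fin.≟ κ)} {r = other} (λ e → complement (does (e Fin.≟ κ))) (allFin n))
      (cong (ℕ._+ # other (allFin n)) loops))
      where
      complement : ∀ b → 1 ≡ bit b ℕ.+ bit (not b)
      complement true  = refl
      complement false = refl
    double : ∀ {n} → Fin n → n ℕ.+ (n ∸ 1) ≡ 2 ℕ.* n ∸ 1
    double {suc n} _ = trans (cong suc (ℕₚ.+-comm n n)) (trans (sym (ℕₚ.+-suc n n)) (cong (λ k → n ℕ.+ suc k) (sym (ℕₚ.+-identityʳ n))))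

  other-κ : other κ ≡ false
  other-κ = cong not (dec-true (κ Fin.≟ κ) refl)

  bipermutation : Bipermutation β
  bipermutation = record
    { len    = length-β
    ; counts = λ e → one-or-two (other e) (count-β e)
    ; single = κ , trans (count-β κ) (cong (suc ∘ bit) other-κ) , only
    }
    where
    one-or-two : ∀ {k} b → k ≡ suc (bit b) → k ≡ 1 ⊎ k ≡ 2
    one-or-two false eq = inj₁ eq
    one-or-two true  eq = inj₂ eq
    only : ∀ e → count e β ≡ 1 → e ≡ κ
    only e eq with e Fin.≟ κ | trans (sym (count-β e)) eq
    ... | yes e≡κ | _  = e≡κ
    ... | no  _   | ()

  -- Leaving out the second copy of `κ` empties no block: `κ` is a loop, so its first occurrence is
  -- listed in the same block.
  block-inhabited : ∀ {j} → j ≤ i → 0 < length (block j)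
  block-inhabited {j} j≤i with covering j≤i
  ... | e , inj₁ eq = ∈-length (∈-++⁺ˡ (∈-select⁺ {e = e} (ℕₚ.≡⇒≡ᵇ _ j eq)))
  ... | e , inj₂ eq with e Fin.≟ κ
  ...   | yes refl = ∈-length (∈-++⁺ˡ (∈-select⁺ {e = κ} (ℕₚ.≡⇒≡ᵇ _ j (trans (proj₂ loop) eq))))
  ...   | no  e≢κ  = ∈-length (∈-++⁺ʳ (select _) (∈-select⁺ {e = e} (from Boolₚ.T-∧ (ℕₚ.≡⇒≡ᵇ _ j eq ,
            T-not (λ t → e≢κ (from-does t))))))
    where
    from-does : T (does (e Fin.≟ κ)) → e ≡ κ
    from-does t with e Fin.≟ κ
    ... | yes eq = eq

  length-prefix-< : ∀ {J K} → J < K → K ≤ suc i → length (prefix J) < length (prefix K)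
  length-prefix-< {J} {suc K} (s≤s J≤K) (s≤s K≤i) = ℕₚ.≤-<-trans (weakly (ℕₚ.m≤n⇒m<n∨m≡n J≤K))
    (subst (length (prefix K) <_) (sym (Listₚ.length-++ (prefix K))) (ℕₚ.m<m+n _ (block-inhabited K≤i)))
    where
    weakly : J < K ⊎ J ≡ K → length (prefix J) ≤ length (prefix K)
    weakly (inj₁ J<K)  = ℕₚ.<⇒≤ (length-prefix-< J<K (ℕₚ.m≤n⇒m≤1+n K≤i))
    weakly (inj₂ refl) = ℕₚ.≤-refl

  prefix-extends : ∀ {J} K → J ≤ K → ∃ λ rest → prefix K ≡ prefix J ++ rest
  prefix-extends {J} K J≤K with ℕₚ.m≤n⇒m<n∨m≡n J≤K
  ... | inj₂ refl = [] , sym (Listₚ.++-identityʳ (prefix J))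
  prefix-extends {J} (suc K) _ | inj₁ (s≤s J≤K) with prefix-extends K J≤K
  ... | rest , eq = rest ++ block K , trans (cong (_++ block K) eq) (Listₚ.++-assoc (prefix J) rest (block K))

  -- Cut `j` comes after blocks 0 to `j`, which is why the prefix has index `suc j`.
  cut : ℕ → ℕ
  cut j = length (prefix (suc j))

  cuts : List ℕ
  cuts = map cut (upTo i)

  -- Both sets are compared through occurrence counts: an element lies left of the cut when its
  -- count in the prefix is positive, and right of it when the prefix does not exhaust its total
  -- count.
  chainRay-cut : ∀ {j} → j < i → chainRay w j ≡ cutRay β (cut j)
  chainRay-cut {j} j<i with prefix-extends (suc i) (s≤s (ℕₚ.<⇒≤ j<i))
  ... | rest , β≡ = cong₂ ray
    (trans (Vec-ext {u = initial w j} initial-≡) (cong setOf (sym take≡)))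
    (trans (Vec-ext {u = final w j} final-≡) (cong setOf (sym drop≡)))
    where
    take≡ : take (cut j) β ≡ prefix (suc j)
    take≡ = trans (cong (take (cut j)) β≡) (take-length (prefix (suc j)) rest)
      where
      take-length : ∀ (xs ys : List (Fin n)) → take (length xs) (xs ++ ys) ≡ xs
      take-length []       ys = refl
      take-length (x ∷ xs) ys = cong (x ∷_) (take-length xs ys)
    drop≡ : drop (cut j) β ≡ rest
    drop≡ = trans (cong (drop (cut j)) β≡) (drop-length (prefix (suc j)) rest)
      where
      drop-length : ∀ (xs ys : List (Fin n)) → drop (length xs) (xs ++ ys) ≡ ys
      drop-length []       ys = refl
      drop-length (x ∷ xs) ys = drop-length xs ys
    initial-≡ : ∀ e → lookup (initial w j) e ≡ lookup (setOf (prefix (suc j))) e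
    initial-≡ e = trans (Vecₚ.lookup-map e _ w) (T-ext
      (λ t → setOf-count⁺ (prefix (suc j)) (subst (0 <_) (sym (count-prefix e (suc j)))
        (ℕₚ.≤-trans (positive {first w e <ᵇ suc j} (ℕₚ.<⇒<ᵇ {first w e} {suc j} (s≤s (ℕₚ.≤ᵇ⇒≤ (first w e) j t)))) (ℕₚ.m≤m+n _ _))))
      (λ t → ℕₚ.≤⇒≤ᵇ {first w e} {j} (ℕₚ.≮⇒≥ (λ j<p → ℕₚ.<-irrefl (sym (zero-count j<p)) (setOf-count⁻ (prefix (suc j)) t)))))
      where
      positive : ∀ {b} → T b → 0 < bit b
      positive {true} _ = s≤s z≤n
      not-below : ∀ {x} → j < x → (x <ᵇ suc j) ≡ false
      not-below {x} j<x = T-ext (λ t → ⊥-elim (ℕₚ.<⇒≱ j<x (ℕₚ.≤-pred (ℕₚ.<ᵇ⇒< x (suc j) t)))) (λ ())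
      zero-count : j < first w e → count e (prefix (suc j)) ≡ 0
      zero-count j<p = trans (count-prefix e (suc j))
        (cong₂ (λ a b → bit a ℕ.+ bit (b ∧ other e)) (not-below j<p) (not-below (ℕₚ.<-≤-trans j<p (ordered e))))
    final-≡ : ∀ e → lookup (final w j) e ≡ lookup (setOf rest) e
    final-≡ e = trans (Vecₚ.lookup-map e _ w) (T-ext
      (λ t → setOf-count⁺ rest (proj₁ decide (λ t′ → ℕₚ.<⇒≱ (ℕₚ.<ᵇ⇒< j (last w e) t) (ℕₚ.≤-pred (ℕₚ.<ᵇ⇒< (last w e) (suc j) t′)))))
      (λ t → ℕₚ.<⇒<ᵇ {j} {last w e} (ℕₚ.≰⇒> (λ r≤j → proj₂ decide (setOf-count⁻ rest t) (ℕₚ.<⇒<ᵇ {last w e} {suc j} (s≤s r≤j))))))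
      where
      total : suc (bit (other e)) ≡ (bit (first w e <ᵇ suc j) ℕ.+ bit ((last w e <ᵇ suc j) ∧ other e)) ℕ.+ count e rest
      total = trans (sym (count-β e)) (trans (cong (count e) β≡) (trans (count-++ e (prefix (suc j)) rest)
        (cong (ℕ._+ count e rest) (count-prefix e (suc j)))))
      loop-case : other e ≡ false → (first w e <ᵇ suc j) ≡ (last w e <ᵇ suc j)
      loop-case eq with e Fin.≟ κ
      ... | yes refl = cong (_<ᵇ suc j) (proj₂ loop)
      loop-case () | no _
      last⇒first : T (last w e <ᵇ suc j) → T (first w e <ᵇ suc j)
      last⇒first t = ℕₚ.<⇒<ᵇ (ℕₚ.≤-<-trans (ordered e) (ℕₚ.<ᵇ⇒< (last w e) (suc j) t))
      -- `a` and `b` say that the first and the last block of the element lie before the cut, `o`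
      -- that it is not `κ`, and `c` is its count in the rest. If `o` holds, then c = 2 - a - b and
      -- `b` implies `a`; otherwise a = b and c = 1 - a. In both cases `c` is positive exactly when
      -- `b` fails.
      balance : ∀ a b o c → suc (bit o) ≡ (bit a ℕ.+ bit (b ∧ o)) ℕ.+ c → (o ≡ false → a ≡ b) → (T b → T a) →
        (¬ T b → 0 < c) × (0 < c → ¬ T b)
      balance a     true  o     c       eq l m = (λ ¬b → ⊥-elim (¬b tt)) , (λ 0<c _ → ℕₚ.<-irrefl (forced a o c eq (m tt)) 0<c)
        where
        forced : ∀ a o c → suc (bit o) ≡ (bit a ℕ.+ bit o) ℕ.+ c → T a → 0 ≡ c
        forced true o c eq _ = ℕₚ.+-cancelˡ-≡ (suc (bit o)) 0 c (trans (ℕₚ.+-identityʳ _) eq)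
      balance a     false o     (suc c) eq l m = (λ _ → s≤s z≤n) , (λ _ ())
      balance true  false true  zero    () l m
      balance true  false false zero    eq l m with () ← l refl
      balance false false true  zero    () l m
      balance false false false zero    () l m
      decide = balance (first w e <ᵇ suc j) (last w e <ᵇ suc j) (other e) (count e rest) total loop-case last⇒first

  chain-cuts : chain i w ≡ map (cutRay β) cuts
  chain-cuts = trans (Listₚ.map-cong-local (All.tabulate (λ j∈ → chainRay-cut (∈-upTo⁻ j∈)))) (Listₚ.map-∘ (upTo i))

  cuts-ascending : AllPairs _<_ cuts
  cuts-ascending = subst (AllPairs _<_) (sym (Listₚ.map-upTo cut i))
    (AllPairsₚ.applyUpTo⁺₁ cut i (λ a<b b<i → length-prefix-< (s≤s a<b) (s≤s (ℕₚ.<⇒≤ b<i))))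

  cuts-positions : ∀ {m} → m ∈ cuts → m ∈ positions n
  cuts-positions m∈ with ∈-map⁻ cut m∈
  ... | j , j∈ , refl = ∈-positions⁺ n
    (length-prefix-< {0} (s≤s z≤n) (s≤s (ℕₚ.<⇒≤ (∈-upTo⁻ j∈))))
    (subst (cut j <_) length-β (length-prefix-< (s≤s (∈-upTo⁻ j∈)) ℕₚ.≤-refl))

  chain-∈ : chain i w ∈ choose i (raysOf n β)
  chain-∈ = subst₂ _∈_ (sym chain-cuts) (sym (choose-map (cutRay β) i (positions n)))
    (∈-map⁺ (map (cutRay β)) (subst (λ k → cuts ∈ choose k (positions n))
      (trans (Listₚ.length-map cut (upTo i)) (Listₚ.length-upTo i))
      (choose⁺ (positions n) (positions-ascending n) cuts-ascending cuts-positions)))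

-- Both lists of codes are free of duplicates, one by `deduplicate` and the other by
-- `code-chain-injective`, so mutual inclusion makes their lengths equal. A cone shared by several
-- bipermutations needs no separate treatment.
fSigma-good : ∀ i n → fSigma i n ≡ # (good (suc i)) (vecs n (letters (suc i)))
fSigma-good i n = begin
  length (iCones n i)                               ≡⟨ ↭-length same ⟩
  length (map (code ∘ chain i) (goodWords n i))     ≡⟨ Listₚ.length-map (code ∘ chain i) (goodWords n i) ⟩
  length (goodWords n i)                            ≡⟨ length-filter-T (good (suc i)) (vecs n (letters (suc i))) ⟩
  # (good (suc i)) (vecs n (letters (suc i)))       ∎
  where
  open ≡-Reasoning
  _≟code_ = Listₚ.≡-dec Bool._≟_
  has-card? = λ c → card c ℕ.≟ i
  cones : List (Fin n) → List (List Bool)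
  cones β = map code (choose i (raysOf n β))
  cone-⊆ : ∀ {c} → c ∈ iCones n i → c ∈ map (code ∘ chain i) (goodWords n i)
  cone-⊆ c∈ with find (∈-concatMap⁻ cones {xs = bipermutations n} (proj₁ (∈-filter⁻ has-card?
      {xs = concatMap cones (bipermutations n)} (∈-deduplicate⁻ _≟code_ _ c∈))))
  ... | β , β∈ , c∈β with ∈-map⁻ code c∈β
  ...   | R , R∈ , refl with cone⇒word i β∈ R∈
  ...     | w , w∈ , eq = subst (_∈ map (code ∘ chain i) (goodWords n i)) (sym eq) (∈-map⁺ (code ∘ chain i) w∈)
  word-⊆ : ∀ {c} → c ∈ map (code ∘ chain i) (goodWords n i) → c ∈ iCones n i
  word-⊆ c∈ with ∈-map⁻ (code ∘ chain i) c∈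
  ... | w , w∈ , refl = ∈-deduplicate⁺ _≟code_ (∈-filter⁺ has-card?
    (∈-concatMap⁺ cones (lose (∈-bipermutations⁺ bipermutation) (∈-map⁺ code chain-∈)))
    (trans (card-code (chain-unique adm)) (trans (Listₚ.length-map (chainRay w) (upTo i)) (Listₚ.length-upTo i))))
    where
    adm = ∈-goodWords⁻ {n} {i} w∈
    open Refine adm
  same : iCones n i ↭ map (code ∘ chain i) (goodWords n i)
  same = ↭-fromUnique (DecUniqueₚ.deduplicate-! _≟code_ _)
    (map-unique (code ∘ chain i) (λ u∈ v∈ → code-chain-injective (∈-goodWords⁻ {n} {i} u∈) (∈-goodWords⁻ {n} {i} v∈)) (goodWords-unique n i))
    cone-⊆ word-⊆

theorem3p2 : (a b : ℕ) → mul2 LHS expX a b ≡ FxExpY a b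
theorem3p2 = generatingFunction (λ i n → trans (cong ι (fSigma-good i (suc n))) (#-good (suc n) (suc i)))
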